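{- Let $p\ge 1/2$ be fixed and let $\epsilon>0$ be an arbitrarily small constant. In the Majority Model (MM) on the cycle $C_n$ started from a $p$-random initial coloring, with probability $1-o(1)$ as $n\to\infty$ the process reaches, within $\mathcal{O}(\log n)$ rounds, a stable coloring whose number of blue nodes is between $(1-\epsilon)\frac{2p^2-p^3}{1-p+p^2}n$ and $(1+\epsilon)\frac{2p^2-p^3}{1-p+p^2}n$.
   Context: A coloring is a map from the nodes to $\{b,w\}$. In MM, all nodes update simultaneously: a node adopts the color strictly more frequent among its neighbors in the previous round and keeps its color in case of a tie. A coloring is stable if one application of the update rule returns it unchanged. A $p$-random coloring colors each node blue independently with probability $p$ and white otherwise. -}

module Defs where

open import Data.Bool.Base using (Bool; true)
open import Data.Fin.Base using (Fin; toℕ)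
open import Data.Integer.Base using (+_)
open import Data.List.Base using (List; []; _∷_; _++_; map; foldr; filter; filterᵇ; length; allFin)
open import Data.Nat.Base as ℕ using (ℕ; zero; suc)
open import Data.Nat.GeneralisedArithmetic using (fold)
import Data.Nat.Properties as ℕ
open import Data.Product.Base using (_×_; _,_; ∃-syntax; proj₁; proj₂)
open import Data.Rational.Base as ℚ using (ℚ; 0ℚ; 1ℚ; ½)
import Data.Rational.Properties as ℚ
open import Data.Rational.Solver using (module +-*-Solver)
open import Data.Sum.Base using (_⊎_; inj₁; inj₂; swap)
open import Data.Vec.Base using (Vec; []; _∷_; lookup; tabulate; count)
open import Relation.Binary.Definitions using (Decidable; DecidableEquality; tri<; tri≈; tri>)
open import Relation.Binary.PropositionalEquality using (_≡_; refl; sym; trans; cong; cong₂; subst; subst₂; module ≡-Reasoning)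
open import Relation.Nullary using (¬_; yes; no)
open import Relation.Nullary.Decidable using (_×-dec_; _⊎-dec_)

-- Real numbers, as Cauchy sequences of rationals.  No quotient is taken:
-- all statements about reals go through _≤_ and _<_ below, which do not
-- depend on the choice of representative.

Cauchy : (ℕ → ℚ) → Set
Cauchy s = ∀ ε → 0ℚ ℚ.< ε →
  ∃[ N ] (∀ m n → N ℕ.≤ m → N ℕ.≤ n → ℚ.∣ s m ℚ.- s n ∣ ℚ.≤ ε)

record ℝ : Set where
  constructor mkℝ
  field
    seq    : ℕ → ℚ
    cauchy : Cauchy seq
open ℝ public

infix  4 _≤_ _<_
infixl 6 _+_ _-_
infixl 7 _*_ _÷_[_]
infix  8 -_
infixr 8 _^_

_≤_ : ℝ → ℝ → Set
x ≤ y = ∀ ε → 0ℚ ℚ.< ε → ∃[ N ] (∀ n → N ℕ.≤ n → seq x n ℚ.≤ seq y n ℚ.+ ε)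

_<_ : ℝ → ℝ → Set
x < y = ∃[ ε ] (0ℚ ℚ.< ε × ∃[ N ] (∀ n → N ℕ.≤ n → seq x n ℚ.+ ε ℚ.≤ seq y n))

private
  open +-*-Solver using (solve; _:=_; _:+_; _:*_; _:-_; :-_; con)

  half : ℚ → ℚ
  half ε = ½ ℚ.* ε

  0<half : ∀ {ε} → 0ℚ ℚ.< ε → 0ℚ ℚ.< half ε
  0<half {ε} 0<ε = ℚ.positive⁻¹ (half ε) {{ℚ.pos*pos⇒pos ½ ε {{ℚ.positive 0<ε}}}}

  half+half : ∀ ε → half ε ℚ.+ half ε ≡ ε
  half+half = solve 1 (λ e → con ½ :* e :+ con ½ :* e := e) refl

  *-mono-≤ : ∀ {a b c d} → 0ℚ ℚ.≤ a → 0ℚ ℚ.≤ d → a ℚ.≤ b → c ℚ.≤ d →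
             a ℚ.* c ℚ.≤ b ℚ.* d
  *-mono-≤ {a} {b} {c} {d} 0≤a 0≤d a≤b c≤d = ℚ.≤-trans
    (ℚ.*-monoˡ-≤-nonNeg a {{ℚ.nonNegative 0≤a}} c≤d)
    (ℚ.*-monoʳ-≤-nonNeg d {{ℚ.nonNegative 0≤d}} a≤b)

  divide : ∀ M η → 0ℚ ℚ.< M → 0ℚ ℚ.< η → ∃[ ζ ] (0ℚ ℚ.< ζ × M ℚ.* ζ ≡ η)
  divide M η 0<M 0<η = 1/M ℚ.* η , ℚ.positive⁻¹ _ {{pos}} , eq
    where
    instance
      M-pos = ℚ.positive 0<M
      M≢0   = ℚ.pos⇒nonZero M
      η-pos = ℚ.positive 0<η
    1/M = ℚ.1/ M
    pos = ℚ.pos*pos⇒pos 1/M {{ℚ.1/pos⇒pos M}} η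
    eq : M ℚ.* (1/M ℚ.* η) ≡ η
    eq = trans (sym (ℚ.*-assoc M 1/M η))
               (trans (cong (ℚ._* η) (ℚ.*-inverseʳ M)) (ℚ.*-identityˡ η))

  eventually-bounded : ∀ s → Cauchy s →
    ∃[ B ] (0ℚ ℚ.< B × ∃[ N ] (∀ n → N ℕ.≤ n → ℚ.∣ s n ∣ ℚ.≤ B))
  eventually-bounded s c with c 1ℚ (ℚ.positive⁻¹ 1ℚ)
  ... | N , h = 1ℚ ℚ.+ ℚ.∣ s N ∣ , pos , N , bound
    where
    pos = ℚ.positive⁻¹ _
      {{ℚ.pos+nonNeg⇒pos 1ℚ ℚ.∣ s N ∣ {{ℚ.nonNegative (ℚ.0≤∣p∣ (s N))}}}}
    split : ∀ a b → (a ℚ.- b) ℚ.+ b ≡ a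
    split = solve 2 (λ a b → (a :- b) :+ b := a) refl
    bound : ∀ n → N ℕ.≤ n → ℚ.∣ s n ∣ ℚ.≤ 1ℚ ℚ.+ ℚ.∣ s N ∣
    bound n N≤n = ℚ.≤-trans
      (subst (λ z → ℚ.∣ z ∣ ℚ.≤ ℚ.∣ s n ℚ.- s N ∣ ℚ.+ ℚ.∣ s N ∣) (split (s n) (s N))
             (ℚ.∣p+q∣≤∣p∣+∣q∣ (s n ℚ.- s N) (s N)))
      (ℚ.+-monoˡ-≤ ℚ.∣ s N ∣ (h n N N≤n ℕ.≤-refl))

fromℚ : ℚ → ℝ
fromℚ q = mkℝ (λ _ → q) λ ε 0<ε → 0 , λ _ _ _ _ →
  subst (λ z → ℚ.∣ z ∣ ℚ.≤ ε) (sym (ℚ.+-inverseʳ q)) (ℚ.<⇒≤ 0<ε)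

fromℕ : ℕ → ℝ
fromℕ n = fromℚ (+ n ℚ./ 1)

0ℝ 1ℝ 2ℝ ½ℝ : ℝ
0ℝ = fromℕ 0
1ℝ = fromℕ 1
2ℝ = fromℕ 2
½ℝ = fromℚ ½

_+_ : ℝ → ℝ → ℝ
x + y = mkℝ (λ n → seq x n ℚ.+ seq y n) +-cauchy
  where
  regroup : ∀ a b a′ b′ →
    (a ℚ.- a′) ℚ.+ (b ℚ.- b′) ≡ (a ℚ.+ b) ℚ.- (a′ ℚ.+ b′)
  regroup = solve 4 (λ a b a′ b′ → (a :- a′) :+ (b :- b′) := (a :+ b) :- (a′ :+ b′)) refl
  +-cauchy : Cauchy (λ n → seq x n ℚ.+ seq y n)
  +-cauchy ε 0<ε with cauchy x (half ε) (0<half 0<ε) | cauchy y (half ε) (0<half 0<ε)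
  ... | N₁ , h₁ | N₂ , h₂ = N₁ ℕ.⊔ N₂ , λ m n N≤m N≤n →
    subst₂ (λ z e → ℚ.∣ z ∣ ℚ.≤ e) (regroup (seq x m) (seq y m) (seq x n) (seq y n)) (half+half ε)
      (ℚ.≤-trans (ℚ.∣p+q∣≤∣p∣+∣q∣ (seq x m ℚ.- seq x n) (seq y m ℚ.- seq y n))
        (ℚ.+-mono-≤
          (h₁ m n (ℕ.m⊔n≤o⇒m≤o N₁ N₂ N≤m) (ℕ.m⊔n≤o⇒m≤o N₁ N₂ N≤n))
          (h₂ m n (ℕ.m⊔n≤o⇒n≤o N₁ N₂ N≤m) (ℕ.m⊔n≤o⇒n≤o N₁ N₂ N≤n))))

-_ : ℝ → ℝ
- x = mkℝ (λ n → ℚ.- seq x n) λ ε 0<ε → proj₁ (cauchy x ε 0<ε) , λ m n N≤m N≤n →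
  subst (ℚ._≤ ε)
    (trans (sym (ℚ.∣-p∣≡∣p∣ (seq x m ℚ.- seq x n))) (cong ℚ.∣_∣ (ℚ.neg-distrib-+ (seq x m) (ℚ.- seq x n))))
    (proj₂ (cauchy x ε 0<ε) m n N≤m N≤n)

_-_ : ℝ → ℝ → ℝ
x - y = x + (- y)

private
  product-close : ∀ A B α β ε a b a′ b′ → 0ℚ ℚ.≤ α → 0ℚ ℚ.≤ β →
    A ℚ.* α ≡ half ε → B ℚ.* β ≡ half ε → ℚ.∣ a ∣ ℚ.≤ A → ℚ.∣ b′ ∣ ℚ.≤ B →
    ℚ.∣ b ℚ.- b′ ∣ ℚ.≤ α → ℚ.∣ a ℚ.- a′ ∣ ℚ.≤ β →
    ℚ.∣ a ℚ.* b ℚ.- a′ ℚ.* b′ ∣ ℚ.≤ ε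
  product-close A B α β ε a b a′ b′ 0≤α 0≤β Aα≡ Bβ≡ a≤A b′≤B b-b′≤α a-a′≤β = begin
    ℚ.∣ a ℚ.* b ℚ.- a′ ℚ.* b′ ∣
      ≡⟨ cong ℚ.∣_∣ (regroup a b a′ b′) ⟨
    ℚ.∣ a ℚ.* (b ℚ.- b′) ℚ.+ b′ ℚ.* (a ℚ.- a′) ∣
      ≤⟨ ℚ.∣p+q∣≤∣p∣+∣q∣ (a ℚ.* (b ℚ.- b′)) (b′ ℚ.* (a ℚ.- a′)) ⟩
    ℚ.∣ a ℚ.* (b ℚ.- b′) ∣ ℚ.+ ℚ.∣ b′ ℚ.* (a ℚ.- a′) ∣
      ≡⟨ cong₂ ℚ._+_ (ℚ.∣p*q∣≡∣p∣*∣q∣ a (b ℚ.- b′)) (ℚ.∣p*q∣≡∣p∣*∣q∣ b′ (a ℚ.- a′)) ⟩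
    ℚ.∣ a ∣ ℚ.* ℚ.∣ b ℚ.- b′ ∣ ℚ.+ ℚ.∣ b′ ∣ ℚ.* ℚ.∣ a ℚ.- a′ ∣
      ≤⟨ ℚ.+-mono-≤ (*-mono-≤ (ℚ.0≤∣p∣ a) 0≤α a≤A b-b′≤α)
                    (*-mono-≤ (ℚ.0≤∣p∣ b′) 0≤β b′≤B a-a′≤β) ⟩
    A ℚ.* α ℚ.+ B ℚ.* β
      ≡⟨ cong₂ ℚ._+_ Aα≡ Bβ≡ ⟩
    half ε ℚ.+ half ε
      ≡⟨ half+half ε ⟩
    ε ∎
    where
    open ℚ.≤-Reasoning
    regroup : ∀ a b a′ b′ →
      a ℚ.* (b ℚ.- b′) ℚ.+ b′ ℚ.* (a ℚ.- a′) ≡ a ℚ.* b ℚ.- a′ ℚ.* b′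
    regroup = solve 4 (λ a b a′ b′ → a :* (b :- b′) :+ b′ :* (a :- a′) := a :* b :- a′ :* b′) refl

  *-cauchy : ∀ s t → Cauchy s → Cauchy t → Cauchy (λ n → s n ℚ.* t n)
  *-cauchy s t cs ct ε 0<ε =
    let A , 0<A , K , s≤A = eventually-bounded s cs
        B , 0<B , L , t≤B = eventually-bounded t ct
        α , 0<α , Aα≡     = divide A (half ε) 0<A (0<half 0<ε)
        β , 0<β , Bβ≡     = divide B (half ε) 0<B (0<half 0<ε)
        M₁ , h₁           = ct α 0<α
        M₂ , h₂           = cs β 0<β
        left  : ∀ {k} → (K ℕ.⊔ L) ℕ.⊔ (M₁ ℕ.⊔ M₂) ℕ.≤ k → K ℕ.⊔ L ℕ.≤ k
        left  = ℕ.m⊔n≤o⇒m≤o (K ℕ.⊔ L) (M₁ ℕ.⊔ M₂)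
        right : ∀ {k} → (K ℕ.⊔ L) ℕ.⊔ (M₁ ℕ.⊔ M₂) ℕ.≤ k → M₁ ℕ.⊔ M₂ ℕ.≤ k
        right = ℕ.m⊔n≤o⇒n≤o (K ℕ.⊔ L) (M₁ ℕ.⊔ M₂)
    in (K ℕ.⊔ L) ℕ.⊔ (M₁ ℕ.⊔ M₂) , λ m n N≤m N≤n →
      product-close A B α β ε (s m) (t m) (s n) (t n)
        (ℚ.<⇒≤ 0<α) (ℚ.<⇒≤ 0<β) Aα≡ Bβ≡
        (s≤A m (ℕ.m⊔n≤o⇒m≤o K L (left N≤m)))
        (t≤B n (ℕ.m⊔n≤o⇒n≤o K L (left N≤n)))
        (h₁ m n (ℕ.m⊔n≤o⇒m≤o M₁ M₂ (right N≤m)) (ℕ.m⊔n≤o⇒m≤o M₁ M₂ (right N≤n)))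
        (h₂ m n (ℕ.m⊔n≤o⇒n≤o M₁ M₂ (right N≤m)) (ℕ.m⊔n≤o⇒n≤o M₁ M₂ (right N≤n)))

_*_ : ℝ → ℝ → ℝ
x * y = mkℝ (λ n → seq x n ℚ.* seq y n) (*-cauchy (seq x) (seq y) (cauchy x) (cauchy y))

_^_ : ℝ → ℕ → ℝ
x ^ zero  = 1ℝ
x ^ suc k = x * x ^ k

⊔-pos : ∀ {ε} → 0ℚ ℚ.< ε → ∀ a → ℚ.Positive (ε ℚ.⊔ a)
⊔-pos {ε} 0<ε a = ℚ.positive (ℚ.<-≤-trans 0<ε (ℚ.p≤p⊔q ε a))

1/⊔ : ∀ {ε} → 0ℚ ℚ.< ε → ℚ → ℚ
1/⊔ {ε} 0<ε a = (ℚ.1/ (ε ℚ.⊔ a)) {{ℚ.pos⇒nonZero (ε ℚ.⊔ a) {{⊔-pos 0<ε a}}}}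

private
  module _ {ε : ℚ} (0<ε : 0ℚ ℚ.< ε) where
    instance
      ε-pos = ℚ.positive 0<ε
      ε≢0   = ℚ.pos⇒nonZero ε

    κ : ℚ
    κ = ℚ.1/ ε

    κ-pos : ℚ.Positive κ
    κ-pos = ℚ.1/pos⇒pos ε

    0≤κ : 0ℚ ℚ.≤ κ
    0≤κ = ℚ.<⇒≤ (ℚ.positive⁻¹ κ {{κ-pos}})

    inv : ℚ → ℚ
    inv = 1/⊔ 0<ε

    0≤inv : ∀ a → 0ℚ ℚ.≤ inv a
    0≤inv a = ℚ.<⇒≤ (ℚ.positive⁻¹ (inv a) {{ℚ.1/pos⇒pos (ε ℚ.⊔ a) {{⊔-pos 0<ε a}}}})

    inv*⊔≡1 : ∀ a → inv a ℚ.* (ε ℚ.⊔ a) ≡ 1ℚ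
    inv*⊔≡1 a = ℚ.*-inverseˡ (ε ℚ.⊔ a) {{ℚ.pos⇒nonZero (ε ℚ.⊔ a) {{⊔-pos 0<ε a}}}}

    inv≤κ : ∀ a → inv a ℚ.≤ κ
    inv≤κ a = begin
      inv a                         ≡⟨ ℚ.*-identityʳ (inv a) ⟨
      inv a ℚ.* 1ℚ                  ≡⟨ cong (inv a ℚ.*_) (ℚ.*-inverseʳ ε) ⟨
      inv a ℚ.* (ε ℚ.* κ)           ≡⟨ ℚ.*-assoc (inv a) ε κ ⟨
      (inv a ℚ.* ε) ℚ.* κ           ≤⟨ ℚ.*-monoʳ-≤-nonNeg κ {{ℚ.nonNegative 0≤κ}}
                                         (ℚ.*-monoˡ-≤-nonNeg (inv a) {{ℚ.nonNegative (0≤inv a)}}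
                                           (ℚ.p≤p⊔q ε a)) ⟩
      (inv a ℚ.* (ε ℚ.⊔ a)) ℚ.* κ   ≡⟨ cong (ℚ._* κ) (inv*⊔≡1 a) ⟩
      1ℚ ℚ.* κ                      ≡⟨ ℚ.*-identityˡ κ ⟩
      κ                             ∎
      where open ℚ.≤-Reasoning

    difference : ∀ u v a b → u ℚ.* a ≡ 1ℚ → v ℚ.* b ≡ 1ℚ →
                 u ℚ.- v ≡ (u ℚ.* v) ℚ.* (b ℚ.- a)
    difference u v a b ua≡1 vb≡1 = begin
      u ℚ.- v
        ≡⟨ cong₂ ℚ._-_ (ℚ.*-identityʳ u) (ℚ.*-identityʳ v) ⟨
      u ℚ.* 1ℚ ℚ.- v ℚ.* 1ℚ
        ≡⟨ cong₂ (λ r s → u ℚ.* r ℚ.- v ℚ.* s) vb≡1 ua≡1 ⟨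
      u ℚ.* (v ℚ.* b) ℚ.- v ℚ.* (u ℚ.* a)
        ≡⟨ solve 4 (λ u v a b → u :* (v :* b) :- v :* (u :* a) := (u :* v) :* (b :- a)) refl u v a b ⟩
      (u ℚ.* v) ℚ.* (b ℚ.- a) ∎
      where open ≡-Reasoning

    0≤inv*inv : ∀ a b → 0ℚ ℚ.≤ inv a ℚ.* inv b
    0≤inv*inv a b = subst (ℚ._≤ inv a ℚ.* inv b) (ℚ.*-zeroʳ (inv a))
      (ℚ.*-monoˡ-≤-nonNeg (inv a) {{ℚ.nonNegative (0≤inv a)}} (0≤inv b))

    inv-close : ∀ ζ a b → 0ℚ ℚ.≤ ζ → ε ℚ.≤ a → ε ℚ.≤ b → ℚ.∣ b ℚ.- a ∣ ℚ.≤ ζ →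
                ℚ.∣ inv a ℚ.- inv b ∣ ℚ.≤ (κ ℚ.* κ) ℚ.* ζ
    inv-close ζ a b 0≤ζ ε≤a ε≤b b-a≤ζ = begin
      ℚ.∣ inv a ℚ.- inv b ∣
        ≡⟨ cong ℚ.∣_∣ (difference (inv a) (inv b) a b (inv*≡1 a ε≤a) (inv*≡1 b ε≤b)) ⟩
      ℚ.∣ (inv a ℚ.* inv b) ℚ.* (b ℚ.- a) ∣
        ≡⟨ ℚ.∣p*q∣≡∣p∣*∣q∣ (inv a ℚ.* inv b) (b ℚ.- a) ⟩
      ℚ.∣ inv a ℚ.* inv b ∣ ℚ.* ℚ.∣ b ℚ.- a ∣
        ≡⟨ cong (ℚ._* ℚ.∣ b ℚ.- a ∣) (ℚ.0≤p⇒∣p∣≡p (0≤inv*inv a b)) ⟩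
      (inv a ℚ.* inv b) ℚ.* ℚ.∣ b ℚ.- a ∣
        ≤⟨ *-mono-≤ (0≤inv*inv a b) 0≤ζ
             (*-mono-≤ (0≤inv a) 0≤κ (inv≤κ a) (inv≤κ b)) b-a≤ζ ⟩
      (κ ℚ.* κ) ℚ.* ζ ∎
      where
      open ℚ.≤-Reasoning
      inv*≡1 : ∀ c → ε ℚ.≤ c → inv c ℚ.* c ≡ 1ℚ
      inv*≡1 c ε≤c = subst (λ z → inv c ℚ.* z ≡ 1ℚ) (ℚ.p≤q⇒p⊔q≡q ε≤c) (inv*⊔≡1 c)

    inv-cauchy : ∀ s → Cauchy s → (N : ℕ) → (∀ n → N ℕ.≤ n → ε ℚ.≤ s n) →
                 Cauchy (λ n → inv (s n))
    inv-cauchy s c N ε≤s η 0<η =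
      let ζ , 0<ζ , κκζ≡η = divide (κ ℚ.* κ) η
            (ℚ.positive⁻¹ (κ ℚ.* κ) {{ℚ.pos*pos⇒pos κ {{κ-pos}} κ {{κ-pos}}}}) 0<η
          M , h = c ζ 0<ζ
      in N ℕ.⊔ M , λ m n N≤m N≤n →
        subst (ℚ.∣ inv (s m) ℚ.- inv (s n) ∣ ℚ.≤_) κκζ≡η
          (inv-close ζ (s m) (s n) (ℚ.<⇒≤ 0<ζ)
            (ε≤s m (ℕ.m⊔n≤o⇒m≤o N M N≤m)) (ε≤s n (ℕ.m⊔n≤o⇒m≤o N M N≤n))
            (h n m (ℕ.m⊔n≤o⇒n≤o N M N≤n) (ℕ.m⊔n≤o⇒n≤o N M N≤m)))

-- The witness ε of 0 < x bounds almost all terms of x from below, so taking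
-- the maximum with ε changes only finitely many terms and makes every term
-- invertible.
recip : (x : ℝ) → 0ℝ < x → ℝ
recip x (ε , 0<ε , N , 0+ε≤x) = mkℝ (λ n → 1/⊔ 0<ε (seq x n))
  (inv-cauchy 0<ε (seq x) (cauchy x) N λ n N≤n →
    subst (ℚ._≤ seq x n) (ℚ.+-identityˡ ε) (0+ε≤x n N≤n))

_÷_[_] : ℝ → (y : ℝ) → 0ℝ < y → ℝ
x ÷ y [ 0<y ] = x * recip y 0<y

data Color : Set where
  blue white : Color

_≟_ : DecidableEquality Color
blue  ≟ blue  = yes refl
blue  ≟ white = no λ ()
white ≟ blue  = no λ ()
white ≟ white = yes refl

record Graph (n : ℕ) : Set₁ where
  field
    _~_      : Fin n → Fin n → Set
    _~?_     : Decidable _~_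
    ~-sym    : ∀ {u v} → u ~ v → v ~ u
    ~-irrefl : ∀ {v} → ¬ (v ~ v)

  neighbours : Fin n → List (Fin n)
  neighbours v = filter (v ~?_) (allFin n)

Coloring : ℕ → Set
Coloring n = Vec Color n

module MM {n : ℕ} (G : Graph n) where
  open Graph G

  neighboursColored : Coloring n → Color → Fin n → ℕ
  neighboursColored c x v = length (filter (λ u → lookup c u ≟ x) (neighbours v))

  newColor : Coloring n → Fin n → Color
  newColor c v with ℕ.<-cmp (neighboursColored c white v) (neighboursColored c blue v)
  ... | tri< _ _ _ = blue
  ... | tri≈ _ _ _ = lookup c v
  ... | tri> _ _ _ = white

  step : Coloring n → Coloring n
  step c = tabulate (newColor c)

  after : ℕ → Coloring n → Coloring n
  after t c = fold c step t

  Stable : Coloring n → Set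
  Stable c = step c ≡ c

blueCount : ∀ {n} → Coloring n → ℕ
blueCount = count (_≟ blue)

CyclicSuc : ∀ {n} → Fin n → Fin n → Set
CyclicSuc {n} u v = suc (toℕ u) ≡ toℕ v ⊎ (suc (toℕ u) ≡ n × toℕ v ≡ 0)

cyclicSuc? : ∀ {n} → Decidable (CyclicSuc {n})
cyclicSuc? {n} u v =
  (suc (toℕ u) ℕ.≟ toℕ v) ⊎-dec ((suc (toℕ u) ℕ.≟ n) ×-dec (toℕ v ℕ.≟ 0))

cycle : ∀ n → 3 ℕ.≤ n → Graph n
cycle n 3≤n = record
  { _~_      = λ u v → CyclicSuc u v ⊎ CyclicSuc v u
  ; _~?_     = λ u v → cyclicSuc? u v ⊎-dec cyclicSuc? v u
  ; ~-sym    = swap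
  ; ~-irrefl = λ { (inj₁ s) → irrefl s ; (inj₂ s) → irrefl s }
  }
  where
  irrefl : ∀ {v : Fin n} → ¬ CyclicSuc v v
  irrefl (inj₁ 1+v≡v)         = ℕ.1+n≢n 1+v≡v
  irrefl (inj₂ (1+v≡n , v≡0)) with subst (3 ℕ.≤_) (trans (sym 1+v≡n) (cong suc v≡0)) 3≤n
  ... | ℕ.s≤s ()

colorings : ∀ n → List (Coloring n)
colorings zero    = [] ∷ []
colorings (suc n) = map (blue ∷_) (colorings n) ++ map (white ∷_) (colorings n)

weight : ∀ {n} → ℝ → Coloring n → ℝ
weight p []          = 1ℝ
weight p (blue  ∷ c) = p * weight p c
weight p (white ∷ c) = (1ℝ - p) * weight p c

Pr : ∀ {n} → ℝ → (Coloring n → Bool) → ℝ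
Pr {n} p S = foldr _+_ 0ℝ (map (weight p) (filterᵇ S (colorings n)))

-- An event given by inequalities between reals need not be decidable, so that
-- the sum of the weights of its elements is not available as a real number.
-- "E has probability at least r" therefore means that a decidable event
-- contained in E does; for decidable E and 0 ≤ p ≤ 1 this is just r ≤ Pr p E.
ProbAtLeast : ∀ {n} → ℝ → (Coloring n → Set) → ℝ → Set
ProbAtLeast {n} p E r =
  ∃[ S ] ((∀ (c : Coloring n) → S c ≡ true → E c) × r ≤ Pr p S)

-- 1 - a + a² = 3/4 + (a - 1/2)²
0<1-p+p² : ∀ p → 0ℝ < 1ℝ - p + p ^ 2
0<1-p+p² p = ¾ , ℚ.positive⁻¹ ¾ , 0 , λ n _ → bound (seq p n)
  where
  ¾ : ℚ
  ¾ = + 3 ℚ./ 4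
  0≤square : ∀ a → 0ℚ ℚ.≤ a ℚ.* a
  0≤square a = subst (0ℚ ℚ.≤_) (∣a∣²≡a² (ℚ.∣p∣≡p∨∣p∣≡-p a))
    (subst (ℚ._≤ ℚ.∣ a ∣ ℚ.* ℚ.∣ a ∣) (ℚ.*-zeroʳ ℚ.∣ a ∣)
      (ℚ.*-monoˡ-≤-nonNeg ℚ.∣ a ∣ {{ℚ.nonNegative (ℚ.0≤∣p∣ a)}} (ℚ.0≤∣p∣ a)))
    where
    ∣a∣²≡a² : ℚ.∣ a ∣ ≡ a ⊎ ℚ.∣ a ∣ ≡ ℚ.- a → ℚ.∣ a ∣ ℚ.* ℚ.∣ a ∣ ≡ a ℚ.* a
    ∣a∣²≡a² (inj₁ e) = cong₂ ℚ._*_ e e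
    ∣a∣²≡a² (inj₂ e) = trans (cong₂ ℚ._*_ e e)
      (solve 1 (λ a → (:- a) :* (:- a) := a :* a) refl a)
  complete-square : ∀ a → ¾ ℚ.+ (a ℚ.- ½) ℚ.* (a ℚ.- ½) ≡
                          (1ℚ ℚ.+ ℚ.- a) ℚ.+ a ℚ.* (a ℚ.* 1ℚ)
  complete-square = solve 1 (λ a → con ¾ :+ (a :- con ½) :* (a :- con ½) :=
                                   (con 1ℚ :+ :- a) :+ a :* (a :* con 1ℚ)) refl
  bound : ∀ a → 0ℚ ℚ.+ ¾ ℚ.≤ (1ℚ ℚ.+ ℚ.- a) ℚ.+ a ℚ.* (a ℚ.* 1ℚ)
  bound a = subst (0ℚ ℚ.+ ¾ ℚ.≤_) (complete-square a)
    (ℚ.+-monoʳ-≤ ¾ (0≤square (a ℚ.- ½)))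

density : ℝ → ℝ
density p = (2ℝ * p ^ 2 - p ^ 3) ÷ (1ℝ - p + p ^ 2) [ 0<1-p+p² p ]

{-# OPTIONS --safe #-}

-- A node of the cycle changes color exactly when both neighbours have the
-- opposite color, and it does so in round t + 1 exactly when the 2 t + 3
-- initial colors around it alternate.  Such a window has probability
-- (p q)^(t+1) with q = 1 - p, so a union bound over the n windows shows that
-- the coloring is stable after log₂ n rounds with probability 1 - O(1/n).
-- Counting the changes to blue and to white separately, the probability that
-- a node is blue after t rounds is p + (p - q) Σ_{1 ≤ j ≤ t} (p q)^j, which
-- tends to (2p² - p³) / (1 - p + p²).  Changing one initial color affects at
-- most 2 t + 1 nodes after t rounds, so by the Efron-Stein inequality the
-- number of blue nodes has variance at most n (2 t + 1)², and Chebyshev's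
-- inequality applies.
--
-- A real p is treated through its rational approximations: all bounds are
-- uniform over rational parameters a in [½, 1], to which the terms of the
-- sequence p are clamped.
module Submission where

open import Defs using (Color; blue; white; Coloring; _≟_; Graph; cycle; CyclicSuc; module MM; blueCount; Cauchy)
open import Data.Bool.Base using (Bool; true; false; _∧_; if_then_else_)
open import Data.Bool.Properties using (∧-identityʳ) renaming (_≟_ to _≟ᵇ_)
open import Data.Fin.Base as Fin using (Fin; toℕ)
open import Data.Fin.Properties using (toℕ-fromℕ<; toℕ-injective; toℕ<n)
import Data.Integer.Base as ℤ
import Data.Integer.Properties as ℤ
open import Data.List.Base using (List; []; _∷_; _++_; filter; filterᵇ; foldr; length; map; allFin)
open import Data.List.Membership.Propositional using (_∈_)
open import Data.List.Membership.Propositional.Properties using (∈-allFin; ∈-filter⁺; ∈-filter⁻)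
open import Data.List.Membership.Propositional.Properties.WithK using (unique∧set⇒bag)
open import Data.List.Properties using (filter-++)
open import Data.List.Relation.Binary.BagAndSetEquality using (∼bag⇒↭)
open import Data.List.Relation.Binary.Permutation.Propositional using (_↭_)
open import Data.List.Relation.Binary.Permutation.Propositional.Properties using (↭-length; filter-↭)
open import Data.List.Relation.Unary.All using ([]; _∷_)
open import Data.List.Relation.Unary.AllPairs using ([]; _∷_)
open import Data.List.Relation.Unary.Any using (here; there)
import Data.List.Relation.Unary.Unique.Propositional.Properties as Unique
open import Data.Nat.Base as ℕ using (ℕ; zero; suc; NonZero)
open import Data.Nat.Coprimality as Coprime using (Coprime; 1-coprimeTo)
open import Data.Nat.DivMod using (_mod_; _%_; m%n<n; m≡m%n+[m/n]*n; [m+kn]%n≡m%n; [m+n]%n≡m%n; m<n⇒m%n≡m; n%n≡0)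
open import Data.Nat.GeneralisedArithmetic using (fold)
open import Data.Nat.Induction using (<-rec)
open import Data.Nat.Logarithm using (⌊log₂_⌋; ⌊log₂⌋-mono-≤; ⌊log₂⌊n/2⌋⌋≡⌊log₂n⌋∸1; ⌊log₂[2^n]⌋≡n)
import Data.Nat.Properties as ℕ
open import Data.Product.Base using (_×_; _,_; ∃-syntax; proj₁; proj₂)
open import Data.Rational.Base as ℚ using (ℚ; 0ℚ; 1ℚ; ½)
import Data.Rational.Properties as ℚ
import Data.Rational.Solver as ℚSolver
import Data.Rational.Unnormalised.Base as ℚᵘ
import Data.Rational.Unnormalised.Properties as ℚᵘ
open import Data.Sum.Base as ⊎ using (_⊎_; inj₁; inj₂)
open import Data.Unit.Base using (tt)
open import Data.Vec.Base using (Vec; []; _∷_; _∷ʳ_; lookup)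
open import Data.Vec.Properties using (lookup∘tabulate; ≡-dec)
open import Function.Base using (_∘_)
open import Function.Bundles using (mk⇔)
open import Relation.Binary.Definitions using (tri<; tri≈; tri>)
open import Relation.Binary.PropositionalEquality using (_≡_; _≢_; refl; sym; trans; cong; cong₂; subst; subst₂; module ≡-Reasoning)
open import Relation.Nullary using (¬_; Dec; yes; no; does; contradiction; T?)
open import Relation.Nullary.Decidable using (map′; _×-dec_; toWitness)

-- Size of the logarithm

-- The order on the reals is not decidable, but `ProbAtLeast` asks for a decidable event, and one
-- event has to serve all terms of the sequence `p`. It is therefore tested against rational
-- thresholds `ρ ± 3 η`, where `ρ` approximates the limiting density, and it must be likely for
-- every parameter `a` that occurs as a clamped term of `p`. This is why `good-likely-log` chooses
-- its bound on `n` before `a`. Clamping is used because `½ ≤ p ≤ 1` bounds the terms only up to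
-- arbitrarily small errors.
--
-- The logarithm has base 2 because `a (1 - a) ≤ ¼`: with `t = ⌊log₂ n⌋` the power `t + 1` of this
-- number is at most `1 / n²`, which survives the union bound, and the constant of the `O(log n)`
-- can be 1. At the same time `(2 t + 1)²` stays small against `n`, as Chebyshev's inequality
-- requires. It also makes windows of length `2 t + 3` fit into the cycle for large `n`, so that the
-- colors in a window are independent.
--
-- Quotients are avoided: the rational density is any `D` with `D * den a ≡ num a`.

module _ where
  open import Data.Nat.Base
  open import Data.Nat.Properties
  open import Data.Nat.Solver using (module +-*-Solver)
  open +-*-Solver using (solve; _:=_; _:+_; _:*_; con)

  n<2^[1+⌊log₂n⌋] : ∀ n → n < 2 ^ suc ⌊log₂ n ⌋
  n<2^[1+⌊log₂n⌋] n with 2 ^ suc ⌊log₂ n ⌋ ≤? n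
  ... | no  ≰n = ≰⇒> ≰n
  ... | yes ≤n = contradiction
    (subst (_≤ ⌊log₂ n ⌋) (⌊log₂[2^n]⌋≡n (suc ⌊log₂ n ⌋)) (⌊log₂⌋-mono-≤ ≤n))
    (<-irrefl refl)

  -- Strong induction along halving, which lowers the logarithm by one.
  2^⌊log₂n⌋≤n : ∀ n → 1 ≤ n → 2 ^ ⌊log₂ n ⌋ ≤ n
  2^⌊log₂n⌋≤n = <-rec (λ n → 1 ≤ n → 2 ^ ⌊log₂ n ⌋ ≤ n) go
    where
    open ≤-Reasoning
    2⌊n/2⌋≤n : ∀ n → 2 * ⌊ n /2⌋ ≤ n
    2⌊n/2⌋≤n n = begin
      2 * ⌊ n /2⌋                ≡⟨ cong (⌊ n /2⌋ +_) (+-identityʳ ⌊ n /2⌋) ⟩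
      ⌊ n /2⌋ + ⌊ n /2⌋         ≤⟨ +-monoʳ-≤ ⌊ n /2⌋ (⌊n/2⌋≤⌈n/2⌉ n) ⟩
      ⌊ n /2⌋ + ⌈ n /2⌉         ≡⟨ ⌊n/2⌋+⌈n/2⌉≡n n ⟩
      n                             ∎
    go : ∀ n → (∀ {m} → m < n → 1 ≤ m → 2 ^ ⌊log₂ m ⌋ ≤ m) → 1 ≤ n → 2 ^ ⌊log₂ n ⌋ ≤ n
    go 1 rec 1≤n = ≤-refl
    go n@(suc (suc k)) rec 1≤n = begin
      2 ^ ⌊log₂ n ⌋
        -- For `n ≥ 2` the logarithm is positive, so the truncated subtraction in the halving law is
        -- a genuine one.
        ≡⟨ cong (2 ^_) (trans (sym (suc-pred _ {{>-nonZero (⌊log₂⌋-mono-≤ {2} {n} (s≤s (s≤s z≤n)))}}))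
             (cong suc (sym (⌊log₂⌊n/2⌋⌋≡⌊log₂n⌋∸1 n)))) ⟩
      2 * 2 ^ ⌊log₂ ⌊ n /2⌋ ⌋
        ≤⟨ *-monoʳ-≤ 2 (rec (⌊n/2⌋<n (suc k)) (⌊n/2⌋-mono {2} {n} (s≤s (s≤s z≤n)))) ⟩
      2 * ⌊ n /2⌋
        ≤⟨ 2⌊n/2⌋≤n n ⟩
      n ∎

  -- The shift 4 is the least from which one step at most doubles the cube: `5³ = 125 ≤ 2 * 4³`,
  -- while `4³ > 2 * 3³`. The constant 64 is the value at `t = 0`.
  [t+4]³≤64*2^t : ∀ t → (4 + t) * ((4 + t) * (4 + t)) ≤ 64 * 2 ^ t
  [t+4]³≤64*2^t zero    = ≤-refl
  [t+4]³≤64*2^t (suc t) = begin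
    (5 + t) * ((5 + t) * (5 + t))
      ≤⟨ m≤m+n _ (t * t * t + 9 * (t * t) + 21 * t + 3) ⟩
    (5 + t) * ((5 + t) * (5 + t)) + (t * t * t + 9 * (t * t) + 21 * t + 3)
      ≡⟨ solve 1 (λ t →
           (con 5 :+ t) :* ((con 5 :+ t) :* (con 5 :+ t)) :+
           (t :* t :* t :+ con 9 :* (t :* t) :+ con 21 :* t :+ con 3) :=
           con 2 :* ((con 4 :+ t) :* ((con 4 :+ t) :* (con 4 :+ t)))) refl t ⟩
    2 * ((4 + t) * ((4 + t) * (4 + t)))
      ≤⟨ *-monoʳ-≤ 2 ([t+4]³≤64*2^t t) ⟩
    2 * (64 * 2 ^ t)
      ≡⟨ solve 1 (λ x → con 2 :* (con 64 :* x) := con 64 :* (con 2 :* x)) refl (2 ^ t) ⟩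
    64 * 2 ^ suc t ∎
    where
    open ≤-Reasoning

  -- The cubic bound has one factor `4 + t` more than `K * K` needs, and for `t ≥ 256 m` this factor
  -- absorbs `m`. The constant 256 is 4 from `K ≤ 2 (4 + t)`, squared, times 64 from the cubic
  -- bound.
  log²-sublinear : ∀ m → ∃[ N ] (∀ n → N ≤ n → let K = 1 + ⌊log₂ n ⌋ * 2 in m * (K * K) ≤ n)
  log²-sublinear m = 2 ^ (256 * m) , bound
    where
    open ≤-Reasoning
    bound : ∀ n → 2 ^ (256 * m) ≤ n → let K = 1 + ⌊log₂ n ⌋ * 2 in m * (K * K) ≤ n
    bound n 2^≤n = *-cancelˡ-≤ 256 (begin
      256 * (m * (K * K))
        ≡⟨ *-assoc 256 m (K * K) ⟨
      256 * m * (K * K)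
        ≤⟨ *-mono-≤ 256m≤4+t (*-mono-≤ K≤2[4+t] K≤2[4+t]) ⟩
      (4 + t) * ((2 * (4 + t)) * (2 * (4 + t)))
        ≡⟨ solve 1 (λ x → x :* ((con 2 :* x) :* (con 2 :* x)) := con 4 :* (x :* (x :* x))) refl (4 + t) ⟩
      4 * ((4 + t) * ((4 + t) * (4 + t)))
        ≤⟨ *-monoʳ-≤ 4 ([t+4]³≤64*2^t t) ⟩
      4 * (64 * 2 ^ t)
        ≡⟨ *-assoc 4 64 (2 ^ t) ⟨
      256 * 2 ^ t
        ≤⟨ *-monoʳ-≤ 256 (2^⌊log₂n⌋≤n n (≤-trans (m^n>0 2 (256 * m)) 2^≤n)) ⟩
      256 * n ∎)
      where
      t = ⌊log₂ n ⌋
      K = 1 + t * 2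
      256m≤4+t : 256 * m ≤ 4 + t
      256m≤4+t = ≤-trans
        (subst (_≤ t) (⌊log₂[2^n]⌋≡n (256 * m)) (⌊log₂⌋-mono-≤ 2^≤n)) (m≤n+m t 4)
      K≤2[4+t] : K ≤ 2 * (4 + t)
      K≤2[4+t] = ≤-trans (m≤n+m K 7) (≤-reflexive
        (solve 1 (λ t → con 7 :+ (con 1 :+ t :* con 2) := con 2 :* (con 4 :+ t)) refl t))

-- Inequalities between rationals

module _ where
  open import Data.Rational.Base hiding (NonZero)
  open import Data.Rational.Properties hiding (_≟_)
  open ℚSolver.+-*-Solver using (solve; _:=_; _:+_; _:*_; _:-_; :-_; con)

  -- Most inequalities below are certified by an explicit nonnegative difference `d`, which leaves a
  -- ring identity for the solver.
  ≤-by : ∀ {x y} d → 0ℚ ≤ d → x + d ≡ y → x ≤ y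
  ≤-by {x} d 0≤d eq = subst₂ _≤_ (+-identityʳ x) eq (+-monoʳ-≤ x 0≤d)

  0≤y-x : ∀ {x y} → x ≤ y → 0ℚ ≤ y - x
  0≤y-x {x} {y} x≤y = subst (_≤ y - x) (+-inverseʳ x) (+-monoˡ-≤ (- x) x≤y)

  0≤+ : ∀ {x y} → 0ℚ ≤ x → 0ℚ ≤ y → 0ℚ ≤ x + y
  0≤+ = +-mono-≤

  0≤* : ∀ {x y} → 0ℚ ≤ x → 0ℚ ≤ y → 0ℚ ≤ x * y
  0≤* {x} {y} 0≤x 0≤y =
    subst (_≤ x * y) (*-zeroʳ x) (*-monoˡ-≤-nonNeg x {{nonNegative 0≤x}} 0≤y)

  0<* : ∀ {x y} → 0ℚ < x → 0ℚ < y → 0ℚ < x * y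
  0<* {x} {y} 0<x 0<y = positive⁻¹ _ {{pos*pos⇒pos x {{positive 0<x}} y {{positive 0<y}}}}

  *-mono : ∀ {a b c d} → 0ℚ ≤ a → 0ℚ ≤ d → a ≤ b → c ≤ d → a * c ≤ b * d
  *-mono {a} {b} {c} {d} 0≤a 0≤d a≤b c≤d = ≤-trans
    (*-monoˡ-≤-nonNeg a {{nonNegative 0≤a}} c≤d)
    (*-monoʳ-≤-nonNeg d {{nonNegative 0≤d}} a≤b)

  0≤square : ∀ x → 0ℚ ≤ x * x
  0≤square x with ≤-total 0ℚ x
  ... | inj₁ 0≤x = 0≤* 0≤x 0≤x
  ... | inj₂ x≤0 = subst (0ℚ ≤_) (solve 1 (λ x → (:- x) :* (:- x) := x :* x) refl x)
                         (0≤* (neg-antimono-≤ x≤0) (neg-antimono-≤ x≤0))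

  square-≤ : ∀ {x y} → x ≤ y → - x ≤ y → x * x ≤ y * y
  square-≤ {x} {y} x≤y -x≤y = ≤-by ((y - x) * (y - - x)) (0≤* (0≤y-x x≤y) (0≤y-x -x≤y))
    (solve 2 (λ x y → x :* x :+ (y :- x) :* (y :- (:- x)) := y :* y) refl x y)

  -- The embedding of ℕ

  -- Written as in `fromℕ`, so that every term of `fromℕ n` is `ι n` by definition.
  ι : ℕ → ℚ
  ι n = ℤ.+ n / 1

  ι-suc : ∀ n → ι (suc n) ≡ 1ℚ + ι n
  ι-suc n = sym (begin
    1ℚ + ι n ≡⟨ cong (1ℚ +_) (normalize-coprime n-coprime-1) ⟩
    1ℚ + mkℚ (ℤ.+ n) 0 n-coprime-1 ≡⟨ cong (λ z → (ℤ.+ 1 ℤ.+ z) / 1) (ℤ.*-identityʳ (ℤ.+ n)) ⟩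
    ι (suc n) ∎)
    where
    open ≡-Reasoning
    n-coprime-1 : Coprime n 1
    n-coprime-1 = Coprime.sym (1-coprimeTo n)

  ι-+ : ∀ m n → ι (m ℕ.+ n) ≡ ι m + ι n
  ι-+ zero n = sym (+-identityˡ (ι n))
  ι-+ (suc m) n = begin
    ι (suc (m ℕ.+ n)) ≡⟨ ι-suc (m ℕ.+ n) ⟩
    1ℚ + ι (m ℕ.+ n)  ≡⟨ cong (1ℚ +_) (ι-+ m n) ⟩
    1ℚ + (ι m + ι n)  ≡⟨ +-assoc 1ℚ (ι m) (ι n) ⟨
    (1ℚ + ι m) + ι n  ≡⟨ cong (_+ ι n) (ι-suc m) ⟨
    ι (suc m) + ι n   ∎
    where open ≡-Reasoning

  ι-* : ∀ m n → ι (m ℕ.* n) ≡ ι m * ι n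
  ι-* zero n = sym (*-zeroˡ (ι n))
  ι-* (suc m) n = begin
    ι (n ℕ.+ m ℕ.* n)   ≡⟨ ι-+ n (m ℕ.* n) ⟩
    ι n + ι (m ℕ.* n)   ≡⟨ cong (λ z → ι n + z) (ι-* m n) ⟩
    ι n + ι m * ι n     ≡⟨ solve 2 (λ m n → n :+ m :* n := (con 1ℚ :+ m) :* n) refl (ι m) (ι n) ⟩
    (1ℚ + ι m) * ι n    ≡⟨ cong (_* ι n) (ι-suc m) ⟨
    ι (suc m) * ι n     ∎
    where open ≡-Reasoning

  0≤1 : 0ℚ ≤ 1ℚ
  0≤1 = nonNegative⁻¹ 1ℚ

  0≤ι : ∀ n → 0ℚ ≤ ι n
  0≤ι zero    = ≤-refl
  0≤ι (suc n) = subst (0ℚ ≤_) (sym (ι-suc n)) (0≤+ 0≤1 (0≤ι n))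

  ι-mono : ∀ {m n} → m ℕ.≤ n → ι m ≤ ι n
  ι-mono {m} {n} m≤n = ≤-by (ι (n ℕ.∸ m)) (0≤ι (n ℕ.∸ m))
    (trans (sym (ι-+ m (n ℕ.∸ m))) (cong ι (ℕ.m+[n∸m]≡n m≤n)))

  -- Finite sums

  Σ< : ℕ → (ℕ → ℚ) → ℚ
  Σ< zero    f = 0ℚ
  Σ< (suc n) f = f 0 + Σ< n (f ∘ suc)

  Σ-cong : ∀ n {f g} → (∀ i → f i ≡ g i) → Σ< n f ≡ Σ< n g
  Σ-cong zero    eq = refl
  Σ-cong (suc n) eq = cong₂ _+_ (eq 0) (Σ-cong n (eq ∘ suc))

  Σ-mono : ∀ n {f g} → (∀ i → f i ≤ g i) → Σ< n f ≤ Σ< n g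
  Σ-mono zero    le = ≤-refl
  Σ-mono (suc n) le = +-mono-≤ (le 0) (Σ-mono n (le ∘ suc))

  Σ-+ : ∀ n f g → Σ< n (λ i → f i + g i) ≡ Σ< n f + Σ< n g
  Σ-+ zero    f g = refl
  Σ-+ (suc n) f g = trans (cong (f 0 + g 0 +_) (Σ-+ n (f ∘ suc) (g ∘ suc)))
    (solve 4 (λ a b c d → (a :+ b) :+ (c :+ d) := (a :+ c) :+ (b :+ d)) refl
      (f 0) (g 0) (Σ< n (f ∘ suc)) (Σ< n (g ∘ suc)))

  Σ-const : ∀ n x → Σ< n (λ _ → x) ≡ ι n * x
  Σ-const zero    x = sym (*-zeroˡ x)
  Σ-const (suc n) x = begin
    x + Σ< n (λ _ → x) ≡⟨ cong (x +_) (Σ-const n x) ⟩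
    x + ι n * x        ≡⟨ solve 2 (λ x n → x :+ n :* x := (con 1ℚ :+ n) :* x) refl x (ι n) ⟩
    (1ℚ + ι n) * x     ≡⟨ cong (_* x) (ι-suc n) ⟨
    ι (suc n) * x      ∎
    where open ≡-Reasoning

  Σ-snoc : ∀ n f → Σ< n f + f n ≡ f 0 + Σ< n (f ∘ suc)
  Σ-snoc zero    f = +-comm 0ℚ (f 0)
  Σ-snoc (suc n) f = trans (+-assoc (f 0) _ _) (cong (f 0 +_) (Σ-snoc n (f ∘ suc)))

  Periodic : {A : Set} → ℕ → (ℕ → A) → Set
  Periodic n f = ∀ i → f (i ℕ.+ n) ≡ f i

  -- The `n + 1` terms up to `f n` lose either their first or their last term, and these two are
  -- equal.
  Σ-suc : ∀ n f → f n ≡ f 0 → Σ< n (f ∘ suc) ≡ Σ< n f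
  Σ-suc n f eq = begin
    Σ< n (f ∘ suc)               ≡⟨ cancel (f 0) (Σ< n (f ∘ suc)) ⟨
    (f 0 + Σ< n (f ∘ suc)) - f 0 ≡⟨ cong (_- f 0) (Σ-snoc n f) ⟨
    (Σ< n f + f n) - f 0         ≡⟨ cong (λ z → (Σ< n f + z) - f 0) eq ⟩
    (Σ< n f + f 0) - f 0         ≡⟨ cong (_- f 0) (+-comm (Σ< n f) (f 0)) ⟩
    (f 0 + Σ< n f) - f 0         ≡⟨ cancel (f 0) (Σ< n f) ⟩
    Σ< n f                       ∎
    where
    open ≡-Reasoning
    cancel : ∀ x y → (x + y) - x ≡ y
    cancel = solve 2 (λ x y → (x :+ y) :- x := y) refl

  Σ-shift : ∀ n m f → Periodic n f → Σ< n (λ i → f (m ℕ.+ i)) ≡ Σ< n f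
  Σ-shift n zero    f per = refl
  Σ-shift n (suc m) f per = trans
    (Σ-shift n m (f ∘ suc) (per ∘ suc)) (Σ-suc n f (per 0))

  -- Expectation over a-random colorings

  -- Recursion on the first node makes conditioning on it definitional; `Pr≡E` relates this to the
  -- sum of weights.
  E : ℚ → ∀ {n} → (Coloring n → ℚ) → ℚ
  E a {zero}  f = f []
  E a {suc n} f = a * E a (λ c → f (blue ∷ c)) + (1ℚ - a) * E a (λ c → f (white ∷ c))

  E-cong : ∀ a {n} {f g : Coloring n → ℚ} → (∀ c → f c ≡ g c) → E a f ≡ E a g
  E-cong a {zero}  eq = eq []
  E-cong a {suc n} eq = cong₂ (λ x y → a * x + (1ℚ - a) * y)
    (E-cong a (λ c → eq (blue ∷ c))) (E-cong a (λ c → eq (white ∷ c)))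

  E-mono : ∀ {a} → 0ℚ ≤ a → a ≤ 1ℚ → ∀ {n} {f g : Coloring n → ℚ} →
           (∀ c → f c ≤ g c) → E a f ≤ E a g
  E-mono 0≤a a≤1 {zero}  le = le []
  E-mono {a} 0≤a a≤1 {suc n} le = +-mono-≤
    (*-monoˡ-≤-nonNeg a {{nonNegative 0≤a}} (E-mono 0≤a a≤1 (λ c → le (blue ∷ c))))
    (*-monoˡ-≤-nonNeg (1ℚ - a) {{nonNegative (0≤y-x a≤1)}} (E-mono 0≤a a≤1 (λ c → le (white ∷ c))))

  E-const : ∀ a n x → E a {n} (λ _ → x) ≡ x
  E-const a zero    x = refl
  E-const a (suc n) x = trans (cong (λ z → a * z + (1ℚ - a) * z) (E-const a n x))
    (solve 2 (λ a x → a :* x :+ (con 1ℚ :- a) :* x := x) refl a x)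

  E-linear : ∀ a {n} x y (f g : Coloring n → ℚ) →
             E a (λ c → x * f c + y * g c) ≡ x * E a f + y * E a g
  E-linear a {zero}  x y f g = refl
  E-linear a {suc n} x y f g = trans
    (cong₂ (λ z w → a * z + (1ℚ - a) * w)
      (E-linear a x y (λ c → f (blue ∷ c)) (λ c → g (blue ∷ c)))
      (E-linear a x y (λ c → f (white ∷ c)) (λ c → g (white ∷ c))))
    (solve 7 (λ a x y p q r s →
        a :* (x :* p :+ y :* q) :+ (con 1ℚ :- a) :* (x :* r :+ y :* s) :=
        x :* (a :* p :+ (con 1ℚ :- a) :* r) :+ y :* (a :* q :+ (con 1ℚ :- a) :* s)) refl
      a x y _ _ _ _)

  E-+ : ∀ a {n} (f g : Coloring n → ℚ) → E a (λ c → f c + g c) ≡ E a f + E a g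
  E-+ a f g = trans
    (E-cong a (λ c → sym (cong₂ _+_ (*-identityˡ (f c)) (*-identityˡ (g c)))))
    (trans (E-linear a 1ℚ 1ℚ f g) (cong₂ _+_ (*-identityˡ (E a f)) (*-identityˡ (E a g))))

  E-Σ : ∀ a {n} m (f : ℕ → Coloring n → ℚ) →
        E a (λ c → Σ< m (λ i → f i c)) ≡ Σ< m (λ i → E a (f i))
  E-Σ a {n} zero f = E-const a n 0ℚ
  E-Σ a (suc m) f = trans (E-+ a (f 0) (λ c → Σ< m (λ i → f (suc i) c)))
    (cong (E a (f 0) +_) (E-Σ a m (f ∘ suc)))

  rotate : ∀ {n} → Coloring n → Coloring n
  rotate []      = []
  rotate (x ∷ c) = c ∷ʳ x

  E-∷ʳ : ∀ a {n} (f : Coloring (suc n) → ℚ) →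
         a * E a (λ c → f (c ∷ʳ blue)) + (1ℚ - a) * E a (λ c → f (c ∷ʳ white)) ≡ E a f
  E-∷ʳ a {zero}  f = refl
  E-∷ʳ a {suc n} f = trans
    (solve 5 (λ a p q r s →
        a :* (a :* p :+ (con 1ℚ :- a) :* q) :+ (con 1ℚ :- a) :* (a :* r :+ (con 1ℚ :- a) :* s) :=
        a :* (a :* p :+ (con 1ℚ :- a) :* r) :+ (con 1ℚ :- a) :* (a :* q :+ (con 1ℚ :- a) :* s)) refl
      a _ _ _ _)
    (cong₂ (λ z w → a * z + (1ℚ - a) * w)
      (E-∷ʳ a (λ c → f (blue ∷ c))) (E-∷ʳ a (λ c → f (white ∷ c))))

  -- Only windows that start at the first node fit the recursion of `E`; rotation brings every other
  -- window there.
  E-rotate : ∀ a {n} (f : Coloring n → ℚ) → E a (f ∘ rotate) ≡ E a f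
  E-rotate a {zero}  f = refl
  E-rotate a {suc n} f = E-∷ʳ a f

  -- Variance of Lipschitz functions

  neq : Color → Color → ℚ
  neq blue  blue  = 0ℚ
  neq blue  white = 1ℚ
  neq white blue  = 1ℚ
  neq white white = 0ℚ

  neq-refl : ∀ x → neq x x ≡ 0ℚ
  neq-refl blue  = refl
  neq-refl white = refl

  hamming : ∀ {n} → Coloring n → Coloring n → ℚ
  hamming []      []       = 0ℚ
  hamming (x ∷ c) (y ∷ c′) = neq x y + hamming c c′

  hamming-refl : ∀ {n} (c : Coloring n) → hamming c c ≡ 0ℚ
  hamming-refl []      = refl
  hamming-refl (x ∷ c) = cong₂ _+_ (neq-refl x) (hamming-refl c)

  hamming-same : ∀ {n} x (c c′ : Coloring n) → hamming (x ∷ c) (x ∷ c′) ≡ hamming c c′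
  hamming-same x c c′ = trans (cong (_+ hamming c c′) (neq-refl x)) (+-identityˡ _)

  Lipschitz : ∀ {n} → ℚ → (Coloring n → ℚ) → Set
  Lipschitz K f = ∀ c c′ → f c ≤ f c′ + K * hamming c c′

  -- Conditioning on the first node: the conditional mean m is again Lipschitz,
  -- and the conditional variance is a (1 - a) (f (blue ∷ c) - f (white ∷ c))².
  efron-stein : ∀ {a} → 0ℚ ≤ a → a ≤ 1ℚ → ∀ {n} {K} {f : Coloring n → ℚ} → Lipschitz K f →
                E a (λ c → f c * f c) ≤ E a f * E a f + ι n * (K * K)
  efron-stein 0≤a a≤1 {zero} {K} {f} lip =
    ≤-reflexive (solve 2 (λ x k → x :* x := x :* x :+ con 0ℚ :* k) refl (f []) (K * K))
  efron-stein {a} 0≤a a≤1 {suc n} {K} {f} lip = begin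
    a * E a (λ c → g c * g c) + b * E a (λ c → h c * h c)
      ≡⟨ E-linear a a b (λ c → g c * g c) (λ c → h c * h c) ⟨
    E a (λ c → a * (g c * g c) + b * (h c * h c))
      ≤⟨ E-mono 0≤a a≤1 pointwise ⟩
    E a (λ c → m c * m c + K * K)
      ≡⟨ trans (E-+ a (λ c → m c * m c) (λ _ → K * K)) (cong (E a (λ c → m c * m c) +_) (E-const a n (K * K))) ⟩
    E a (λ c → m c * m c) + K * K
      ≤⟨ +-monoˡ-≤ (K * K) (efron-stein 0≤a a≤1 {K = K} m-lip) ⟩
    (E a m * E a m + ι n * (K * K)) + K * K
      ≡⟨ cong (λ z → (z * z + ι n * (K * K)) + K * K) (E-linear a a b g h) ⟩
    (E a f * E a f + ι n * (K * K)) + K * K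
      ≡⟨ solve 3 (λ x n k → (x :+ n :* k) :+ k := x :+ (con 1ℚ :+ n) :* k) refl (E a f * E a f) (ι n) (K * K) ⟩
    E a f * E a f + (1ℚ + ι n) * (K * K)
      ≡⟨ cong (λ z → E a f * E a f + z * (K * K)) (ι-suc n) ⟨
    E a f * E a f + ι (suc n) * (K * K) ∎
    where
    open ≤-Reasoning
    b : ℚ
    b = 1ℚ - a
    0≤b : 0ℚ ≤ b
    0≤b = 0≤y-x a≤1
    g h m : Coloring n → ℚ
    g c = f (blue ∷ c)
    h c = f (white ∷ c)
    m c = a * g c + b * h c
    m-lip : Lipschitz K m
    m-lip c c′ = ≤-trans
      (+-mono-≤ (*-monoˡ-≤-nonNeg a {{nonNegative 0≤a}} (lip (blue ∷ c) (blue ∷ c′)))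
                (*-monoˡ-≤-nonNeg b {{nonNegative 0≤b}} (lip (white ∷ c) (white ∷ c′))))
      (≤-reflexive (trans
        (cong₂ (λ x y → a * (g c′ + K * x) + b * (h c′ + K * y))
          (hamming-same blue c c′) (hamming-same white c c′))
        (solve 5 (λ a k d x y →
            a :* (x :+ k :* d) :+ (con 1ℚ :- a) :* (y :+ k :* d) :=
            (a :* x :+ (con 1ℚ :- a) :* y) :+ k :* d) refl
          a K (hamming c c′) (g c′) (h c′))))
    flip≤ : ∀ c x y → neq x y ≡ 1ℚ → f (x ∷ c) - f (y ∷ c) ≤ K
    flip≤ c x y eq = ≤-by ((f (y ∷ c) + K * 1ℚ) - f (x ∷ c))
      (0≤y-x (subst (λ z → f (x ∷ c) ≤ f (y ∷ c) + K * z)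
        (cong₂ _+_ eq (hamming-refl c)) (lip (x ∷ c) (y ∷ c))))
      (solve 3 (λ x y k → (x :- y) :+ ((y :+ k :* con 1ℚ) :- x) := k) refl (f (x ∷ c)) (f (y ∷ c)) K)
    pointwise : ∀ c → a * (g c * g c) + b * (h c * h c) ≤ m c * m c + K * K
    -- The right side exceeds the left by `K * K - a (1 - a) (d * d)`. Splitting off `K * K - d * d`
    -- leaves `d * d` with the nonnegative coefficient `1 - a (1 - a)`.
    pointwise c = ≤-by
      ((K * K - d * d) + ((1ℚ - a) + a * a) * (d * d))
      (0≤+ (0≤y-x (square-≤ (flip≤ c blue white refl)
                    (subst (_≤ K) (solve 2 (λ x y → x :- y := :- (y :- x)) refl (h c) (g c))
                      (flip≤ c white blue refl))))
           (0≤* (0≤+ 0≤b (0≤square a)) (0≤square d)))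
      (solve 4 (λ a x y k →
          (a :* (x :* x) :+ (con 1ℚ :- a) :* (y :* y)) :+
          ((k :- (x :- y) :* (x :- y)) :+ ((con 1ℚ :- a) :+ a :* a) :* ((x :- y) :* (x :- y))) :=
          (a :* x :+ (con 1ℚ :- a) :* y) :* (a :* x :+ (con 1ℚ :- a) :* y) :+ k) refl
        a (g c) (h c) (K * K))
      where
      d : ℚ
      d = g c - h c

  variance-≤ : ∀ {a} → 0ℚ ≤ a → a ≤ 1ℚ → ∀ {n} {K} {f : Coloring n → ℚ} → Lipschitz K f →
               ∀ {m} → E a f ≡ m → E a (λ c → (f c - m) * (f c - m)) ≤ ι n * (K * K)
  variance-≤ {a} 0≤a a≤1 {n} {K} {f} lip {m} mean = begin
    E a (λ c → (f c - m) * (f c - m))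
      ≡⟨ E-cong a (λ c → solve 2 (λ x m → (x :- m) :* (x :- m) :=
           x :* x :+ ((:- (m :+ m)) :* x :+ (m :* m) :* con 1ℚ)) refl (f c) m) ⟩
    E a (λ c → f c * f c + (- (m + m) * f c + (m * m) * 1ℚ))
      ≡⟨ E-+ a (λ c → f c * f c) (λ c → - (m + m) * f c + (m * m) * 1ℚ) ⟩
    E a (λ c → f c * f c) + E a (λ c → - (m + m) * f c + (m * m) * 1ℚ)
      ≡⟨ cong (E a (λ c → f c * f c) +_) (trans (E-linear a (- (m + m)) (m * m) f (λ _ → 1ℚ))
           (cong₂ (λ x y → - (m + m) * x + (m * m) * y) mean (E-const a n 1ℚ))) ⟩
    E a (λ c → f c * f c) + (- (m + m) * m + (m * m) * 1ℚ)
      ≤⟨ +-monoˡ-≤ (- (m + m) * m + (m * m) * 1ℚ) (efron-stein 0≤a a≤1 {K = K} lip) ⟩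
    (E a f * E a f + ι n * (K * K)) + (- (m + m) * m + (m * m) * 1ℚ)
      ≡⟨ cong (λ x → (x * x + ι n * (K * K)) + (- (m + m) * m + (m * m) * 1ℚ)) mean ⟩
    (m * m + ι n * (K * K)) + (- (m + m) * m + (m * m) * 1ℚ)
      ≡⟨ solve 2 (λ m k → (m :* m :+ k) :+ ((:- (m :+ m)) :* m :+ (m :* m) :* con 1ℚ) := k) refl m (ι n * (K * K)) ⟩
    ι n * (K * K) ∎
    where open ≤-Reasoning

  -- The cycle as a periodic sequence

  ext : ∀ {n} .{{_ : NonZero n}} → Coloring n → ℕ → Color
  ext {n} c i = lookup c (i mod n)

  mod-cong : ∀ {i j} n .{{_ : NonZero n}} → i % n ≡ j % n → i mod n ≡ j mod n
  mod-cong {i} {j} n eq = toℕ-injective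
    (trans (toℕ-fromℕ< (m%n<n i n)) (trans eq (sym (toℕ-fromℕ< (m%n<n j n)))))

  toℕ-mod : ∀ {n} .{{_ : NonZero n}} (v : Fin n) → toℕ v mod n ≡ v
  toℕ-mod {n} v = toℕ-injective (trans (toℕ-fromℕ< (m%n<n (toℕ v) n)) (m<n⇒m%n≡m (toℕ<n v)))

  ext-toℕ : ∀ {n} .{{_ : NonZero n}} (c : Coloring n) v → ext c (toℕ v) ≡ lookup c v
  ext-toℕ c v = cong (lookup c) (toℕ-mod v)

  ext-periodic : ∀ {n} .{{_ : NonZero n}} (c : Coloring n) → Periodic n (ext c)
  ext-periodic {n} c i = cong (lookup c) (mod-cong n ([m+n]%n≡m%n i n))

  suc-mod : ∀ n .{{_ : NonZero n}} i → CyclicSuc (i mod n) (suc i mod n)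
  suc-mod n i = result (ℕ.m≤n⇒m<n∨m≡n (m%n<n i n))
    where
    i≡ : toℕ (i mod n) ≡ i % n
    i≡ = toℕ-fromℕ< (m%n<n i n)
    si≡ : toℕ (suc i mod n) ≡ suc (i % n) % n
    si≡ = trans (toℕ-fromℕ< (m%n<n (suc i) n))
      (trans (cong (λ z → suc z % n) (m≡m%n+[m/n]*n i n)) ([m+kn]%n≡m%n (suc (i % n)) (i ℕ./ n) n))
    result : suc (i % n) ℕ.< n ⊎ suc (i % n) ≡ n → CyclicSuc (i mod n) (suc i mod n)
    result (inj₁ lt) = inj₁ (trans (cong suc i≡) (sym (trans si≡ (m<n⇒m%n≡m lt))))
    result (inj₂ eq) = inj₂ (trans (cong suc i≡) eq
      , trans si≡ (trans (cong (_% n) eq) (n%n≡0 n)))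

  lookup-∷ʳ-init : ∀ {n} {A : Set} (xs : Vec A n) x u v → toℕ u ≡ toℕ v →
                   lookup (xs ∷ʳ x) u ≡ lookup xs v
  lookup-∷ʳ-init (y ∷ xs) x Fin.zero    Fin.zero    eq = refl
  lookup-∷ʳ-init (y ∷ xs) x (Fin.suc u) (Fin.suc v) eq = lookup-∷ʳ-init xs x u v (ℕ.suc-injective eq)

  lookup-∷ʳ-last : ∀ {n} {A : Set} (xs : Vec A n) x u → toℕ u ≡ n → lookup (xs ∷ʳ x) u ≡ x
  lookup-∷ʳ-last []       x Fin.zero    eq = refl
  lookup-∷ʳ-last (y ∷ xs) x (Fin.suc u) eq = lookup-∷ʳ-last xs x u (ℕ.suc-injective eq)

  lookup-rotate : ∀ {n} (c : Coloring n) {u v} → CyclicSuc u v → lookup (rotate c) u ≡ lookup c v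
  lookup-rotate (x ∷ c) {u} {Fin.suc v} (inj₁ eq)       = lookup-∷ʳ-init c x u v (ℕ.suc-injective eq)
  lookup-rotate (x ∷ c) {u} {Fin.zero}  (inj₂ (eq , _)) = lookup-∷ʳ-last c x u (ℕ.suc-injective eq)

  ext-rotate : ∀ {n} .{{_ : NonZero n}} (c : Coloring n) i → ext (rotate c) i ≡ ext c (suc i)
  ext-rotate {n} c i = lookup-rotate c (suc-mod n i)

  -- Neighbourhoods in the cycle and the update rule

  cyclicSuc-functional : ∀ {n} {u v w : Fin n} → CyclicSuc u v → CyclicSuc u w → v ≡ w
  cyclicSuc-functional (inj₁ p) (inj₁ q) = toℕ-injective (trans (sym p) q)
  cyclicSuc-functional {v = v} (inj₁ p) (inj₂ (q , _)) = contradiction (trans (sym p) q) (ℕ.<⇒≢ (toℕ<n v))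
  cyclicSuc-functional {w = w} (inj₂ (p , _)) (inj₁ q) = contradiction (trans (sym q) p) (ℕ.<⇒≢ (toℕ<n w))
  cyclicSuc-functional (inj₂ (_ , p)) (inj₂ (_ , q)) = toℕ-injective (trans p (sym q))

  cyclicSuc-injective : ∀ {n} {u v w : Fin n} → CyclicSuc u w → CyclicSuc v w → u ≡ v
  cyclicSuc-injective (inj₁ p) (inj₁ q) = toℕ-injective (ℕ.suc-injective (trans p (sym q)))
  cyclicSuc-injective (inj₁ p) (inj₂ (_ , q)) with () ← trans p q
  cyclicSuc-injective (inj₂ (_ , p)) (inj₁ q) with () ← trans q p
  cyclicSuc-injective (inj₂ (p , _)) (inj₂ (q , _)) = toℕ-injective (ℕ.suc-injective (trans p (sym q)))

  -- Two nodes that succeed each other would close up a cycle of length at most 2. Hence predecessor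
  -- and successor of a node are distinct and cast two separate votes.
  cyclicSuc-asym : ∀ {n} → 3 ℕ.≤ n → {u v : Fin n} → CyclicSuc u v → ¬ CyclicSuc v u
  cyclicSuc-asym 3≤n (inj₁ p) (inj₁ q) = ℕ.<-asym (ℕ.≤-reflexive p) (ℕ.≤-reflexive q)
  cyclicSuc-asym 3≤n (inj₁ p) (inj₂ (q , r)) =
    ℕ.<⇒≢ 3≤n (trans (cong (suc ∘ suc) (sym r)) (trans (cong suc p) q))
  cyclicSuc-asym 3≤n (inj₂ (p , r)) (inj₁ q) =
    ℕ.<⇒≢ 3≤n (trans (cong (suc ∘ suc) (sym r)) (trans (cong suc q) p))
  cyclicSuc-asym 3≤n (inj₂ (p , r)) (inj₂ (q , s)) =
    ℕ.<⇒≢ (ℕ.<⇒≤ 3≤n) (trans (cong suc (sym s)) p)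

  -- With two neighbours, keeping the color on a tie amounts to the majority of three that includes
  -- the node itself.
  maj : Color → Color → Color → Color
  maj blue  m blue  = blue
  maj blue  m white = m
  maj white m blue  = m
  maj white m white = white

  module _ {n : ℕ} (3≤n : 3 ℕ.≤ n) where
    open Graph (cycle n 3≤n)
    open MM (cycle n 3≤n)

    -- The order in which filtering lists the two neighbours depends on where the cycle wraps
    -- around, so the list is determined only up to permutation. Two lists without repetition and
    -- with the same elements are permutations of each other, and the counts below are invariant
    -- under permutation.
    neighbours-↭ : ∀ {u v w} → CyclicSuc u v → CyclicSuc v w → neighbours v ↭ u ∷ w ∷ []
    neighbours-↭ {u} {v} {w} uv vw = ∼bag⇒↭ (unique∧set⇒bag
      (Unique.filter⁺ (v ~?_) (Unique.allFin⁺ n)) ((u≢w ∷ []) ∷ [] ∷ [])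
      (mk⇔ (to ∘ proj₂ ∘ ∈-filter⁻ (v ~?_) {xs = allFin n}) from))
      where
      u≢w : u ≢ w
      u≢w refl = cyclicSuc-asym 3≤n uv vw
      to : ∀ {z} → v ~ z → z ∈ u ∷ w ∷ []
      to (inj₁ vz) = there (here (cyclicSuc-functional vz vw))
      to (inj₂ zv) = here (cyclicSuc-injective zv uv)
      from : ∀ {z} → z ∈ u ∷ w ∷ [] → z ∈ neighbours v
      from (here refl)         = ∈-filter⁺ (v ~?_) (∈-allFin u) (inj₂ uv)
      from (there (here refl)) = ∈-filter⁺ (v ~?_) (∈-allFin w) (inj₁ vw)

    private
      pairCount : Color → Color → Color → ℕ
      pairCount x l r = length (filter (_≟ x) (l ∷ r ∷ []))

      length-filter-map : ∀ {A : Set} (f : A → Color) x zs →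
        length (filter (λ z → f z ≟ x) zs) ≡ length (filter (_≟ x) (map f zs))
      length-filter-map f x []       = refl
      length-filter-map f x (z ∷ zs) with does (f z ≟ x)
      ... | true  = cong suc (length-filter-map f x zs)
      ... | false = length-filter-map f x zs

      maj-< : ∀ l m r → pairCount white l r ℕ.< pairCount blue l r → blue ≡ maj l m r
      maj-< blue  m blue  lt = refl
      maj-< blue  m white lt = contradiction lt (ℕ.<-irrefl refl)
      maj-< white m blue  lt = contradiction lt (ℕ.<-irrefl refl)
      maj-< white m white ()

      maj-≡ : ∀ l m r → pairCount white l r ≡ pairCount blue l r → m ≡ maj l m r
      maj-≡ blue  m blue  ()
      maj-≡ blue  m white eq = refl
      maj-≡ white m blue  eq = refl
      maj-≡ white m white ()

      maj-> : ∀ l m r → pairCount blue l r ℕ.< pairCount white l r → white ≡ maj l m r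
      maj-> blue  m blue  ()
      maj-> blue  m white lt = contradiction lt (ℕ.<-irrefl refl)
      maj-> white m blue  lt = contradiction lt (ℕ.<-irrefl refl)
      maj-> white m white lt = refl

    newColor-maj : ∀ c {u v w} → CyclicSuc u v → CyclicSuc v w →
                   newColor c v ≡ maj (lookup c u) (lookup c v) (lookup c w)
    newColor-maj c {u} {v} {w} uv vw
      -- Matching on the very comparison that defines `newColor` makes it reduce; the equations from
      -- `counts` then move each case to the two colors.
      with ℕ.<-cmp (neighboursColored c white v) (neighboursColored c blue v)
         | counts white | counts blue
      where
      counts : ∀ x → neighboursColored c x v ≡ pairCount x (lookup c u) (lookup c w)
      counts x = trans (↭-length (filter-↭ (λ z → lookup c z ≟ x) (neighbours-↭ uv vw)))
                       (length-filter-map (lookup c) x (u ∷ w ∷ []))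
    ... | tri< lt _ _ | ew | eb = maj-< (lookup c u) (lookup c v) (lookup c w) (subst₂ ℕ._<_ ew eb lt)
    ... | tri≈ _ eq _ | ew | eb = maj-≡ (lookup c u) (lookup c v) (lookup c w) (trans (sym ew) (trans eq eb))
    ... | tri> _ _ gt | ew | eb = maj-> (lookup c u) (lookup c v) (lookup c w) (subst₂ ℕ._<_ eb ew gt)

  -- The majority rule on sequences

  -- Node 1 + i moves to position i, so that t rounds make position i depend
  -- on the positions i , … , i + 2 t only.
  Φ : (ℕ → Color) → ℕ → Color
  Φ s i = maj (s i) (s (suc i)) (s (suc (suc i)))

  module _ {n : ℕ} (3≤n : 3 ℕ.≤ n) .{{_ : NonZero n}} where
    open MM (cycle n 3≤n)

    ext-step : ∀ c i → ext (step c) (suc i) ≡ Φ (ext c) i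
    ext-step c i = trans (lookup∘tabulate (newColor c) (suc i mod n))
      (newColor-maj 3≤n c (suc-mod n i) (suc-mod n (suc i)))

    ext-after : ∀ c t i → ext (after t c) (t ℕ.+ i) ≡ fold (ext c) Φ t i
    ext-after c zero    i = refl
    ext-after c (suc t) i = begin
      ext (step d) (suc (t ℕ.+ i))
        ≡⟨ ext-step d (t ℕ.+ i) ⟩
      maj (ext d (t ℕ.+ i)) (ext d (suc (t ℕ.+ i))) (ext d (suc (suc (t ℕ.+ i))))
        ≡⟨ cong₂ (λ j k → maj (ext d (t ℕ.+ i)) (ext d j) (ext d k)) (ℕ.+-suc t i)
             (trans (ℕ.+-suc t (suc i)) (cong suc (ℕ.+-suc t i))) ⟨
      maj (ext d (t ℕ.+ i)) (ext d (t ℕ.+ suc i)) (ext d (t ℕ.+ suc (suc i)))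
        ≡⟨ cong₂ (λ x y → maj x y (ext d (t ℕ.+ suc (suc i)))) (ext-after c t i) (ext-after c t (suc i)) ⟩
      maj (u i) (u (suc i)) (ext d (t ℕ.+ suc (suc i)))
        ≡⟨ cong (maj (u i) (u (suc i))) (ext-after c t (suc (suc i))) ⟩
      Φ u i ∎
      where
      open ≡-Reasoning
      d = after t c
      u = fold (ext c) Φ t

  -- Alternating windows

  ∀? : ∀ {P : Color → Set} → (∀ x → Dec (P x)) → Dec (∀ x → P x)
  ∀? P? = map′ (λ { (b , w) blue → b ; (b , w) white → w }) (λ f → f blue , f white)
               (P? blue ×-dec P? white)

  opp : Color → Color
  opp blue  = white
  opp white = blue

  same : Color → Color → Bool
  same x y = does (x ≟ y)

  alt : Color → ℕ → (ℕ → Color) → ℕ → Bool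
  alt x zero    s i = true
  alt x (suc L) s i = same (s i) x ∧ alt (opp x) L s (suc i)

  -- Two equal adjacent colors both survive a round, so alternation cannot arise from a window that
  -- contains them. Length 3 is the least for which this works: `x x y y` already yields the two
  -- alternating outputs `x y`. The first color is `x` on both sides because the change of each
  -- interior node and the index shift of `Φ` compensate.
  alt-Φ : ∀ m x s i → alt x (3 ℕ.+ m) (Φ s) i ≡ alt x (5 ℕ.+ m) s i
  alt-Φ zero x s i = table x (s i) (s (1 ℕ.+ i)) (s (2 ℕ.+ i)) (s (3 ℕ.+ i)) (s (4 ℕ.+ i))
    where
    table : ∀ x a b c d e →
      same (maj a b c) x ∧ same (maj b c d) (opp x) ∧ same (maj c d e) (opp (opp x)) ∧ true ≡
      same a x ∧ same b (opp x) ∧ same c (opp (opp x)) ∧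
        same d (opp (opp (opp x))) ∧ same e (opp (opp (opp (opp x)))) ∧ true
    -- All 64 cases are checked by evaluating the decision procedure.
    table = toWitness {a? = ∀? λ x → ∀? λ a → ∀? λ b → ∀? λ c → ∀? λ d → ∀? λ e → _ ≟ᵇ _} tt
  alt-Φ (suc m) x s i = trans
    (cong (same (Φ s i) x ∧_) (alt-Φ m (opp x) s (suc i)))
    -- The tail fixes `b` and `c` as two different colors, and then `maj a b c` is `a`. The rest of
    -- the window enters only as a Boolean `r`.
    (table (alt (opp (opp (opp x))) (3 ℕ.+ m) s (3 ℕ.+ i)) x (s i) (s (1 ℕ.+ i)) (s (2 ℕ.+ i)))
    where
    table : ∀ r x a b c →
      same (maj a b c) x ∧ same b (opp x) ∧ same c (opp (opp x)) ∧ r ≡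
      same a x ∧ same b (opp x) ∧ same c (opp (opp x)) ∧ r
    table true  = toWitness {a? = ∀? λ x → ∀? λ a → ∀? λ b → ∀? λ c → _ ≟ᵇ _} tt
    table false = toWitness {a? = ∀? λ x → ∀? λ a → ∀? λ b → ∀? λ c → _ ≟ᵇ _} tt

  -- Peeling off the last round lengthens the window by two, so the induction needs an arbitrary
  -- `m`.
  alt-fold : ∀ t m x s i → alt x (3 ℕ.+ m) (fold s Φ t) i ≡ alt x (3 ℕ.+ (m ℕ.+ t ℕ.* 2)) s i
  alt-fold zero    m x s i = cong (λ k → alt x (3 ℕ.+ k) s i) (sym (ℕ.+-identityʳ m))
  alt-fold (suc t) m x s i = begin
    alt x (3 ℕ.+ m) (Φ (fold s Φ t)) i         ≡⟨ alt-Φ m x (fold s Φ t) i ⟩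
    alt x (5 ℕ.+ m) (fold s Φ t) i             ≡⟨ alt-fold t (2 ℕ.+ m) x s i ⟩
    alt x (5 ℕ.+ (m ℕ.+ t ℕ.* 2)) s i          ≡⟨ cong (λ k → alt x (3 ℕ.+ k) s i)
                                                    (trans (ℕ.+-suc m (suc (t ℕ.* 2))) (cong suc (ℕ.+-suc m (t ℕ.* 2)))) ⟨
    alt x (3 ℕ.+ (m ℕ.+ suc t ℕ.* 2)) s i      ∎
    where open ≡-Reasoning

  alt-cong : ∀ x L {s s′} i → (∀ j → s (suc j) ≡ s′ j) → alt x L s (suc i) ≡ alt x L s′ i
  alt-cong x zero    i eq = refl
  alt-cong x (suc L) i eq = cong₂ _∧_ (cong (λ y → same y x) (eq i)) (alt-cong (opp x) L (suc i) eq)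

  𝟙 : Bool → ℚ
  𝟙 b = if b then 1ℚ else 0ℚ

  isBlue : Color → ℚ
  isBlue x = 𝟙 (same x blue)

  -- An alternating triple is a change to blue if it starts with blue and a change to white
  -- otherwise. The coefficients `1ℚ` and `- 1ℚ` are spelled out to fit `E-linear`.
  isBlue-Φ : ∀ u i → isBlue (Φ u i) ≡
    isBlue (u (suc i)) + (1ℚ * 𝟙 (alt blue 3 u i) + (- 1ℚ) * 𝟙 (alt white 3 u i))
  isBlue-Φ u i = table (u i) (u (suc i)) (u (suc (suc i)))
    where
    table : ∀ a b c → isBlue (maj a b c) ≡ isBlue b +
      (1ℚ * 𝟙 (same a blue ∧ same b white ∧ same c blue ∧ true) +
       (- 1ℚ) * 𝟙 (same a white ∧ same b blue ∧ same c white ∧ true))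
    table = toWitness {a? = ∀? λ a → ∀? λ b → ∀? λ c → _ ℚ.≟ _} tt

  neq-Φ : ∀ u i → neq (Φ u i) (u (suc i)) ≡ 𝟙 (alt blue 3 u i) + 𝟙 (alt white 3 u i)
  neq-Φ u i = table (u i) (u (suc i)) (u (suc (suc i)))
    where
    table : ∀ a b c → neq (maj a b c) b ≡
      𝟙 (same a blue ∧ same b white ∧ same c blue ∧ true) +
      𝟙 (same a white ∧ same b blue ∧ same c white ∧ true)
    table = toWitness {a? = ∀? λ a → ∀? λ b → ∀? λ c → _ ℚ.≟ _} tt

  -- Expectations of local observables

  prob : ℚ → Color → ℚ
  prob a blue  = a
  prob a white = 1ℚ - a

  altProb : ℚ → Color → ℕ → ℚ
  altProb a x zero    = 1ℚ
  altProb a x (suc L) = prob a x * altProb a (opp x) L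

  -- The window at the first node, by the same recursion as `E`. The value `false` on an exhausted
  -- coloring is never reached when `L ≤ n`.
  altV : ∀ {n} → Color → ℕ → Coloring n → Bool
  altV x zero    c       = true
  altV x (suc L) []      = false
  altV x (suc L) (y ∷ c) = same y x ∧ altV (opp x) L c

  -- By `L ≤ n` the window does not run around the cycle, so it reads each node at most once.
  alt≡altV : ∀ {n} x L s i (c : Coloring n) → L ℕ.≤ n →
             (∀ v → s (i ℕ.+ toℕ v) ≡ lookup c v) → alt x L s i ≡ altV x L c
  alt≡altV x zero    s i c       L≤n agree = refl
  alt≡altV x (suc L) s i (y ∷ c) (ℕ.s≤s L≤n) agree = cong₂ _∧_
    (cong (λ z → same z x) (trans (cong s (sym (ℕ.+-identityʳ i))) (agree Fin.zero)))
    (alt≡altV (opp x) L s (suc i) c L≤n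
      (λ v → trans (cong s (sym (ℕ.+-suc i (toℕ v)))) (agree (Fin.suc v))))

  E-altV : ∀ a {n} x L → L ℕ.≤ n → E a (λ (c : Coloring n) → 𝟙 (altV x L c)) ≡ altProb a x L
  E-altV a {n} x zero L≤n = E-const a n 1ℚ
  E-altV a {suc n} blue (suc L) (ℕ.s≤s L≤n) = trans
    (cong₂ (λ y z → a * y + (1ℚ - a) * z) (E-altV a white L L≤n) (E-const a n 0ℚ))
    (solve 2 (λ a x → a :* x :+ (con 1ℚ :- a) :* con 0ℚ := a :* x) refl a _)
  E-altV a {suc n} white (suc L) (ℕ.s≤s L≤n) = trans
    (cong₂ (λ y z → a * y + (1ℚ - a) * z) (E-const a n 0ℚ) (E-altV a blue L L≤n))
    (solve 2 (λ a x → a :* con 0ℚ :+ (con 1ℚ :- a) :* x := (con 1ℚ :- a) :* x) refl a _)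

  E-alt : ∀ a {n} .{{_ : NonZero n}} x L i → L ℕ.≤ n →
          E a (λ (c : Coloring n) → 𝟙 (alt x L (ext c) i)) ≡ altProb a x L
  E-alt a x L zero L≤n = trans
    (E-cong a (λ c → cong 𝟙 (alt≡altV x L (ext c) 0 c L≤n (ext-toℕ c)))) (E-altV a x L L≤n)
  E-alt a x L (suc i) L≤n = trans
    (E-cong a (λ c → cong 𝟙 (alt-cong x L i (λ j → sym (ext-rotate c j)))))
    (trans (E-rotate a (λ c → 𝟙 (alt x L (ext c) i))) (E-alt a x L i L≤n))

  pow : ℚ → ℕ → ℚ
  pow r zero    = 1ℚ
  pow r (suc t) = r * pow r t

  altProb-odd : ∀ a x t → altProb a x (1 ℕ.+ t ℕ.* 2) ≡ prob a x * pow (a * (1ℚ - a)) t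
  altProb-odd a x     zero    = refl
  altProb-odd a blue  (suc t) = trans
    (cong (λ z → a * ((1ℚ - a) * z)) (altProb-odd a blue t))
    (solve 3 (λ a b z → a :* (b :* (a :* z)) := a :* ((a :* b) :* z)) refl a (1ℚ - a) _)
  altProb-odd a white (suc t) = trans
    (cong (λ z → (1ℚ - a) * (a * z)) (altProb-odd a white t))
    (solve 3 (λ a b z → b :* (a :* (b :* z)) := b :* ((a :* b) :* z)) refl a (1ℚ - a) _)

  blueProb : ℚ → ℕ → ℚ
  blueProb a zero    = a
  blueProb a (suc t) =
    blueProb a t + (a * pow (a * (1ℚ - a)) (suc t) - (1ℚ - a) * pow (a * (1ℚ - a)) (suc t))

  E-fold : ∀ a {n} .{{_ : NonZero n}} t i → 1 ℕ.+ t ℕ.* 2 ℕ.≤ n →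
           E a (λ (c : Coloring n) → isBlue (fold (ext c) Φ t i)) ≡ blueProb a t
  E-fold a zero i le = trans
    (E-cong a (λ c → cong 𝟙 (sym (∧-identityʳ (same (ext c i) blue)))))
    (trans (E-alt a blue 1 i le) (*-identityʳ a))
  E-fold a {n} (suc t) i le = begin
    E a (λ c → isBlue (Φ (fold (ext c) Φ t) i))
      ≡⟨ E-cong a (λ c → trans (isBlue-Φ (fold (ext c) Φ t) i)
           (cong₂ (λ y z → isBlue (fold (ext c) Φ t (suc i)) + (1ℚ * 𝟙 y + (- 1ℚ) * 𝟙 z))
             (alt-fold t 0 blue (ext c) i) (alt-fold t 0 white (ext c) i))) ⟩
    E a (λ c → f c + (1ℚ * g blue c + (- 1ℚ) * g white c))
      ≡⟨ E-+ a f (λ c → 1ℚ * g blue c + (- 1ℚ) * g white c) ⟩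
    E a f + E a (λ c → 1ℚ * g blue c + (- 1ℚ) * g white c)
      ≡⟨ cong₂ _+_ (E-fold a t (suc i) (ℕ.≤-trans (ℕ.n≤1+n _) (ℕ.≤-trans (ℕ.n≤1+n _) le)))
           (trans (E-linear a 1ℚ (- 1ℚ) (g blue) (g white))
             (cong₂ (λ y z → 1ℚ * y + (- 1ℚ) * z) (E-g blue) (E-g white))) ⟩
    blueProb a t + (1ℚ * (a * q) + (- 1ℚ) * ((1ℚ - a) * q))
      ≡⟨ cong (blueProb a t +_) (solve 2 (λ x y → con 1ℚ :* x :+ con (- 1ℚ) :* y := x :- y) refl (a * q) ((1ℚ - a) * q)) ⟩
    blueProb a (suc t) ∎
    where
    open ≡-Reasoning
    q : ℚ
    q = pow (a * (1ℚ - a)) (suc t)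
    f : Coloring n → ℚ
    f c = isBlue (fold (ext c) Φ t (suc i))
    g : Color → Coloring n → ℚ
    g x c = 𝟙 (alt x (3 ℕ.+ t ℕ.* 2) (ext c) i)
    E-g : ∀ x → E a (g x) ≡ prob a x * q
    E-g x = trans (E-alt a x (3 ℕ.+ t ℕ.* 2) i le) (altProb-odd a x (suc t))

  -- Spread of a disagreement between two colorings

  neq-≥0 : ∀ x y → 0ℚ ≤ neq x y
  neq-≥0 blue  blue  = ≤-refl
  neq-≥0 blue  white = 0≤1
  neq-≥0 white blue  = 0≤1
  neq-≥0 white white = ≤-refl

  isBlue-neq : ∀ x y → isBlue x ≤ isBlue y + neq x y
  isBlue-neq blue  blue  = ≤-refl
  isBlue-neq blue  white = ≤-refl
  isBlue-neq white blue  = ≤ᵇ⇒≤ tt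
  isBlue-neq white white = ≤-refl

  neq≤1 : ∀ x y → neq x y ≤ 1ℚ
  neq≤1 blue  blue  = 0≤1
  neq≤1 blue  white = ≤-refl
  neq≤1 white blue  = ≤-refl
  neq≤1 white white = 0≤1

  neq-≢ : ∀ {x y} → x ≢ y → neq x y ≡ 1ℚ
  neq-≢ {blue}  {blue}  x≢y = contradiction refl x≢y
  neq-≢ {blue}  {white} x≢y = refl
  neq-≢ {white} {blue}  x≢y = refl
  neq-≢ {white} {white} x≢y = contradiction refl x≢y

  -- A common bound `w` takes the place of the sum of the three disagreements. In `neq-fold` it is
  -- the sum over the enlarged window, in which each position counts once, whereas adding three
  -- overlapping windows would count positions repeatedly in every round.
  neq-maj : ∀ a b c a′ b′ c′ {w} → neq a a′ ≤ w → neq b b′ ≤ w → neq c c′ ≤ w →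
            neq (maj a b c) (maj a′ b′ c′) ≤ w
  neq-maj a b c a′ b′ c′ ha hb hc with a ≟ a′ | b ≟ b′ | c ≟ c′
  ... | no a≢a′  | _        | _        = ≤-trans (neq≤1 (maj a b c) _) (subst (_≤ _) (neq-≢ a≢a′) ha)
  ... | yes _    | no b≢b′  | _        = ≤-trans (neq≤1 (maj a b c) _) (subst (_≤ _) (neq-≢ b≢b′) hb)
  ... | yes _    | yes _    | no c≢c′  = ≤-trans (neq≤1 (maj a b c) _) (subst (_≤ _) (neq-≢ c≢c′) hc)
  ... | yes refl | yes refl | yes refl =
    subst (_≤ _) (sym (neq-refl (maj a b c))) (≤-trans (neq-≥0 a a) ha)

  windowSum : ℕ → (ℕ → ℚ) → ℕ → ℚ
  windowSum zero    e i = 0ℚ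
  windowSum (suc L) e i = e i + windowSum L e (suc i)

  module _ {e : ℕ → ℚ} (0≤e : ∀ i → 0ℚ ≤ e i) where

    windowSum-extend : ∀ L i → windowSum L e i ≤ windowSum (suc L) e i
    windowSum-extend zero    i = ≤-trans (0≤e i) (≤-reflexive (sym (+-identityʳ (e i))))
    windowSum-extend (suc L) i = +-monoʳ-≤ (e i) (windowSum-extend L (suc i))

    windowSum-tail : ∀ L i → windowSum L e (suc i) ≤ windowSum (suc L) e i
    windowSum-tail L i =
      subst (_≤ windowSum (suc L) e i) (+-identityˡ _) (+-monoˡ-≤ (windowSum L e (suc i)) (0≤e i))

  windowSum-periodic : ∀ {n e} L → Periodic n e → Periodic n (windowSum L e)
  windowSum-periodic zero    per i = refl
  windowSum-periodic (suc L) per i = cong₂ _+_ (per i) (windowSum-periodic L per (suc i))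

  Σ-windowSum : ∀ n {e} L → Periodic n e → Σ< n (windowSum L e) ≡ ι L * Σ< n e
  Σ-windowSum n {e} zero per = trans (Σ-const n 0ℚ) (trans (*-zeroʳ (ι n)) (sym (*-zeroˡ (Σ< n e))))
  Σ-windowSum n {e} (suc L) per = begin
    Σ< n (λ i → e i + windowSum L e (suc i))
      ≡⟨ Σ-+ n e (windowSum L e ∘ suc) ⟩
    Σ< n e + Σ< n (windowSum L e ∘ suc)
      ≡⟨ cong (Σ< n e +_) (trans (Σ-suc n (windowSum L e) (windowSum-periodic L per 0)) (Σ-windowSum n L per)) ⟩
    Σ< n e + ι L * Σ< n e
      ≡⟨ solve 2 (λ x l → x :+ l :* x := (con 1ℚ :+ l) :* x) refl (Σ< n e) (ι L) ⟩
    (1ℚ + ι L) * Σ< n e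
      ≡⟨ cong (_* Σ< n e) (ι-suc L) ⟨
    ι (suc L) * Σ< n e ∎
    where open ≡-Reasoning

  neq-fold : ∀ t s s′ i →
    neq (fold s Φ t i) (fold s′ Φ t i) ≤ windowSum (1 ℕ.+ t ℕ.* 2) (λ j → neq (s j) (s′ j)) i
  neq-fold zero    s s′ i = ≤-reflexive (sym (+-identityʳ _))
  neq-fold (suc t) s s′ i =
    neq-maj (u i) (u (1 ℕ.+ i)) (u (2 ℕ.+ i)) (u′ i) (u′ (1 ℕ.+ i)) (u′ (2 ℕ.+ i))
      (≤-trans (neq-fold t s s′ i)
        (≤-trans (windowSum-extend 0≤e L i) (windowSum-extend 0≤e (suc L) i)))
      (≤-trans (neq-fold t s s′ (1 ℕ.+ i))
        (≤-trans (windowSum-tail 0≤e L i) (windowSum-extend 0≤e (suc L) i)))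
      (≤-trans (neq-fold t s s′ (2 ℕ.+ i))
        (≤-trans (windowSum-tail 0≤e L (suc i)) (windowSum-tail 0≤e (suc L) i)))
    where
    u u′ : ℕ → Color
    u  = fold s Φ t
    u′ = fold s′ Φ t
    L : ℕ
    L = 1 ℕ.+ t ℕ.* 2
    0≤e : ∀ j → 0ℚ ≤ neq (s j) (s′ j)
    0≤e j = neq-≥0 (s j) (s′ j)

  -- Counts as sums over one period

  Agrees : ∀ {n} → (ℕ → Color) → Coloring n → Set
  Agrees s c = ∀ v → s (toℕ v) ≡ lookup c v

  hamming-Σ : ∀ {n} s s′ (c c′ : Coloring n) → Agrees s c → Agrees s′ c′ →
              hamming c c′ ≡ Σ< n (λ i → neq (s i) (s′ i))
  hamming-Σ s s′ []      []       h h′ = refl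
  hamming-Σ s s′ (x ∷ c) (y ∷ c′) h h′ = cong₂ _+_
    (sym (cong₂ neq (h Fin.zero) (h′ Fin.zero)))
    (hamming-Σ (s ∘ suc) (s′ ∘ suc) c c′ (h ∘ Fin.suc) (h′ ∘ Fin.suc))

  blueCount-Σ : ∀ {n} s (c : Coloring n) → Agrees s c → ι (blueCount c) ≡ Σ< n (isBlue ∘ s)
  blueCount-Σ s []          h = refl
  blueCount-Σ s (blue ∷ c)  h = trans (ι-suc (blueCount c)) (cong₂ _+_
    (sym (cong isBlue (h Fin.zero))) (blueCount-Σ (s ∘ suc) c (h ∘ Fin.suc)))
  blueCount-Σ s (white ∷ c) h = trans (sym (+-identityˡ (ι (blueCount c)))) (cong₂ _+_
    (sym (cong isBlue (h Fin.zero))) (blueCount-Σ (s ∘ suc) c (h ∘ Fin.suc)))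

  hamming-≥0 : ∀ {n} (c c′ : Coloring n) → 0ℚ ≤ hamming c c′
  hamming-≥0 []      []       = ≤-refl
  hamming-≥0 (x ∷ c) (y ∷ c′) = 0≤+ (neq-≥0 x y) (hamming-≥0 c c′)

  -- Makes the number of changes an upper bound for the indicator of instability, as Markov's
  -- inequality needs.
  hamming-≢ : ∀ {n} (c c′ : Coloring n) → c ≢ c′ → 1ℚ ≤ hamming c c′
  hamming-≢ []      []       c≢c′ = contradiction refl c≢c′
  hamming-≢ (x ∷ c) (y ∷ c′) c≢c′ with x ≟ y
  ... | no x≢y   = subst (_≤ neq x y + hamming c c′) (cong (_+ 0ℚ) (neq-≢ x≢y))
                     (+-monoʳ-≤ (neq x y) (hamming-≥0 c c′))
  ... | yes refl = subst (1ℚ ≤_) (sym (hamming-same x c c′)) (hamming-≢ c c′ (c≢c′ ∘ cong (x ∷_)))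

  -- Concentration

  module _ {n : ℕ} (3≤n : 3 ℕ.≤ n) .{{_ : NonZero n}} (t : ℕ) where
    open MM (cycle n 3≤n)

    blues : Coloring n → ℚ
    blues c = ι (blueCount (after t c))

    changes : Coloring n → ℚ
    changes c = hamming (step (after t c)) (after t c)

    -- The shift by `t` that `Φ` introduces does not affect a sum over a full period.
    blues-Σ : ∀ c → blues c ≡ Σ< n (λ i → isBlue (fold (ext c) Φ t i))
    blues-Σ c = begin
      blues c
        ≡⟨ blueCount-Σ (ext d) d (ext-toℕ d) ⟩
      Σ< n (isBlue ∘ ext d)
        ≡⟨ Σ-shift n t (isBlue ∘ ext d) (λ i → cong isBlue (ext-periodic d i)) ⟨
      Σ< n (λ i → isBlue (ext d (t ℕ.+ i)))
        ≡⟨ Σ-cong n (λ i → cong isBlue (ext-after 3≤n c t i)) ⟩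
      Σ< n (λ i → isBlue (fold (ext c) Φ t i)) ∎
      where
      open ≡-Reasoning
      d = after t c

    blues-lipschitz : Lipschitz (ι (1 ℕ.+ t ℕ.* 2)) blues
    blues-lipschitz c c′ = begin
      blues c
        ≡⟨ blues-Σ c ⟩
      Σ< n (λ i → isBlue (u i))
        ≤⟨ Σ-mono n (λ i → ≤-trans (isBlue-neq (u i) (u′ i)) (+-monoʳ-≤ (isBlue (u′ i)) (neq-fold t (ext c) (ext c′) i))) ⟩
      Σ< n (λ i → isBlue (u′ i) + windowSum L e i)
        ≡⟨ Σ-+ n (isBlue ∘ u′) (windowSum L e) ⟩
      Σ< n (isBlue ∘ u′) + Σ< n (windowSum L e)
        ≡⟨ cong₂ _+_ (sym (blues-Σ c′)) (trans (Σ-windowSum n L e-periodic)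
             (cong (ι L *_) (sym (hamming-Σ (ext c) (ext c′) c c′ (ext-toℕ c) (ext-toℕ c′))))) ⟩
      blues c′ + ι L * hamming c c′ ∎
      where
      open ≤-Reasoning
      L = 1 ℕ.+ t ℕ.* 2
      u = fold (ext c) Φ t
      u′ = fold (ext c′) Φ t
      e : ℕ → ℚ
      e i = neq (ext c i) (ext c′ i)
      e-periodic : Periodic n e
      e-periodic i = cong₂ neq (ext-periodic c i) (ext-periodic c′ i)

    E-blues : ∀ a → 1 ℕ.+ t ℕ.* 2 ℕ.≤ n → E a blues ≡ ι n * blueProb a t
    E-blues a le = begin
      E a blues                                               ≡⟨ E-cong a blues-Σ ⟩
      E a (λ c → Σ< n (λ i → isBlue (fold (ext c) Φ t i)))    ≡⟨ E-Σ a n (λ i c → isBlue (fold (ext c) Φ t i)) ⟩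
      Σ< n (λ i → E a (λ c → isBlue (fold (ext {n} c) Φ t i))) ≡⟨ Σ-cong n (λ i → E-fold a t i le) ⟩
      Σ< n (λ _ → blueProb a t)                               ≡⟨ Σ-const n (blueProb a t) ⟩
      ι n * blueProb a t                                      ∎
      where open ≡-Reasoning

    changes-Σ : ∀ c → changes c ≡
      Σ< n (λ i → 𝟙 (alt blue (3 ℕ.+ t ℕ.* 2) (ext c) i) + 𝟙 (alt white (3 ℕ.+ t ℕ.* 2) (ext c) i))
    changes-Σ c = begin
      changes c
        ≡⟨ hamming-Σ (ext d′) (ext d) d′ d (ext-toℕ d′) (ext-toℕ d) ⟩
      Σ< n (λ i → neq (ext d′ i) (ext d i))
        ≡⟨ Σ-shift n (suc t) (λ i → neq (ext d′ i) (ext d i))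
             (λ i → cong₂ neq (ext-periodic d′ i) (ext-periodic d i)) ⟨
      Σ< n (λ i → neq (ext d′ (suc t ℕ.+ i)) (ext d (suc t ℕ.+ i)))
        ≡⟨ Σ-cong n (λ i → cong₂ neq (ext-after 3≤n c (suc t) i)
             (trans (cong (ext d) (sym (ℕ.+-suc t i))) (ext-after 3≤n c t (suc i)))) ⟩
      Σ< n (λ i → neq (Φ u i) (u (suc i)))
        ≡⟨ Σ-cong n (λ i → trans (neq-Φ u i)
             (cong₂ (λ y z → 𝟙 y + 𝟙 z) (alt-fold t 0 blue (ext c) i) (alt-fold t 0 white (ext c) i))) ⟩
      Σ< n (λ i → 𝟙 (alt blue (3 ℕ.+ t ℕ.* 2) (ext c) i) + 𝟙 (alt white (3 ℕ.+ t ℕ.* 2) (ext c) i)) ∎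
      where
      open ≡-Reasoning
      d = after t c
      d′ = step d
      u = fold (ext c) Φ t

    E-changes : ∀ a → 3 ℕ.+ t ℕ.* 2 ℕ.≤ n → E a changes ≡ ι n * pow (a * (1ℚ - a)) (suc t)
    E-changes a le = begin
      E a changes
        ≡⟨ E-cong a changes-Σ ⟩
      E a (λ c → Σ< n (λ i → g blue i c + g white i c))
        ≡⟨ E-Σ a n (λ i c → g blue i c + g white i c) ⟩
      Σ< n (λ i → E a (λ c → g blue i c + g white i c))
        ≡⟨ Σ-cong n (λ i → trans (E-+ a (g blue i) (g white i)) (cong₂ _+_ (E-g blue i) (E-g white i))) ⟩
      Σ< n (λ _ → a * q + (1ℚ - a) * q)
        ≡⟨ Σ-const n (a * q + (1ℚ - a) * q) ⟩
      ι n * (a * q + (1ℚ - a) * q)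
        ≡⟨ cong (ι n *_) (solve 2 (λ a q → a :* q :+ (con 1ℚ :- a) :* q := q) refl a q) ⟩
      ι n * q ∎
      where
      open ≡-Reasoning
      q = pow (a * (1ℚ - a)) (suc t)
      g : Color → ℕ → Coloring n → ℚ
      g x i c = 𝟙 (alt x (3 ℕ.+ t ℕ.* 2) (ext c) i)
      E-g : ∀ x i → E a (g x i) ≡ prob a x * q
      E-g x i = trans (E-alt a x (3 ℕ.+ t ℕ.* 2) i le) (altProb-odd a x (suc t))

    -- Markov's inequality for the number of changes and Chebyshev's inequality
    -- for the number of blue nodes, multiplied by M².
    concentration : ∀ {a} → 0ℚ ≤ a → a ≤ 1ℚ → 3 ℕ.+ t ℕ.* 2 ℕ.≤ n →
      ∀ (S : Coloring n → Bool) M → let μ = ι n * blueProb a t in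
      (∀ c → S c ≡ true ⊎ step (after t c) ≢ after t c ⊎ M * M ≤ (blues c - μ) * (blues c - μ)) →
      M * M ≤ M * M * (E a (λ c → 𝟙 (S c)) + ι n * pow (a * (1ℚ - a)) (suc t))
              + ι n * (ι (1 ℕ.+ t ℕ.* 2) * ι (1 ℕ.+ t ℕ.* 2))
    concentration {a} 0≤a a≤1 le S M cover = begin
      M * M
        ≡⟨ E-const a n (M * M) ⟨
      E a (λ (c : Coloring n) → M * M)
        ≤⟨ E-mono 0≤a a≤1 (λ c → pointwise c (cover c)) ⟩
      E a (λ c → M * M * (𝟙 (S c) + changes c) + 1ℚ * D c)
        ≡⟨ E-linear a (M * M) 1ℚ (λ c → 𝟙 (S c) + changes c) D ⟩
      M * M * E a (λ c → 𝟙 (S c) + changes c) + 1ℚ * E a D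
        ≡⟨ cong₂ (λ y z → M * M * y + z)
             (trans (E-+ a (𝟙 ∘ S) changes) (cong (E a (𝟙 ∘ S) +_) (E-changes a le)))
             (*-identityˡ (E a D)) ⟩
      M * M * (E a (𝟙 ∘ S) + ι n * pow (a * (1ℚ - a)) (suc t)) + E a D
        ≤⟨ +-monoʳ-≤ (M * M * (E a (𝟙 ∘ S) + ι n * pow (a * (1ℚ - a)) (suc t))) variance ⟩
      M * M * (E a (𝟙 ∘ S) + ι n * pow (a * (1ℚ - a)) (suc t)) + ι n * (K * K) ∎
      where
      open ≤-Reasoning
      K μ : ℚ
      K = ι (1 ℕ.+ t ℕ.* 2)
      μ = ι n * blueProb a t
      D : Coloring n → ℚ
      D c = (blues c - μ) * (blues c - μ)
      0≤𝟙 : ∀ b → 0ℚ ≤ 𝟙 b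
      0≤𝟙 true  = 0≤1
      0≤𝟙 false = ≤-refl
      -- Each alternative of `cover` makes one of the three nonnegative terms reach `M * M`. Taking
      -- expectations then gives both tail bounds and their union bound at once.
      pointwise : ∀ c → S c ≡ true ⊎ step (after t c) ≢ after t c ⊎ M * M ≤ D c →
                  M * M ≤ M * M * (𝟙 (S c) + changes c) + 1ℚ * D c
      pointwise c (inj₁ Sc) = ≤-by (M * M * changes c + D c)
        (0≤+ (0≤* (0≤square M) (hamming-≥0 (step (after t c)) (after t c))) (0≤square (blues c - μ)))
        (trans (solve 3 (λ m h d → m :+ (m :* h :+ d) := m :* (con 1ℚ :+ h) :+ con 1ℚ :* d) refl (M * M) (changes c) (D c))
          (cong (λ b → M * M * (𝟙 b + changes c) + 1ℚ * D c) (sym Sc)))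
      pointwise c (inj₂ (inj₁ unstable)) = ≤-by (M * M * 𝟙 (S c) + M * M * (changes c - 1ℚ) + D c)
        (0≤+ (0≤+ (0≤* (0≤square M) (0≤𝟙 (S c))) (0≤* (0≤square M) (0≤y-x (hamming-≢ _ _ unstable))))
             (0≤square (blues c - μ)))
        (solve 4 (λ m s h d → m :+ (m :* s :+ m :* (h :- con 1ℚ) :+ d) := m :* (s :+ h) :+ con 1ℚ :* d) refl
          (M * M) (𝟙 (S c)) (changes c) (D c))
      pointwise c (inj₂ (inj₂ far)) = ≤-by (M * M * (𝟙 (S c) + changes c) + (D c - M * M))
        (0≤+ (0≤* (0≤square M) (0≤+ (0≤𝟙 (S c)) (hamming-≥0 (step (after t c)) (after t c)))) (0≤y-x far))
        (solve 3 (λ m s d → m :+ (m :* s :+ (d :- m)) := m :* s :+ con 1ℚ :* d) refl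
          (M * M) (𝟙 (S c) + changes c) (D c))
      mean : E a blues ≡ μ
      mean = E-blues a (ℕ.≤-trans (ℕ.n≤1+n _) (ℕ.≤-trans (ℕ.n≤1+n _) le))
      variance : E a D ≤ ι n * (K * K)
      variance = variance-≤ 0≤a a≤1 {K = K} blues-lipschitz mean

  -- The denominator `suc d` of `x` works, because the product is the positive numerator.
  archimedean : ∀ x → 0ℚ < x → ∃[ m ] 1ℚ ≤ ι m * x
  archimedean x@(mkℚ (ℤ.+ suc k) d _) 0<x = suc d , toℚᵘ-cancel-≤ (ℚᵘ.≤-respʳ-≃
    (ℚᵘ.≃-sym (ℚᵘ.≃-trans (toℚᵘ-homo-* (ι (suc d)) x)
      (ℚᵘ.*-congʳ {toℚᵘ x} (toℚᵘ-cong (normalize-coprime (Coprime.sym (1-coprimeTo (suc d))))))))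
    (ℚᵘ.*≤* (ℤ.+≤+ (subst₂ ℕ._≤_ (sym (ℕ.*-identityˡ _)) (sym (ℕ.*-identityʳ _))
      (subst (ℕ._≤ suc d ℕ.* suc k) (ℕ.*-comm (suc d) 1) (ℕ.*-monoʳ-≤ (suc d) (ℕ.s≤s ℕ.z≤n)))))))
  archimedean (mkℚ (ℤ.+ zero) d _)  0<x = contradiction (drop-*<* 0<x) λ { (ℤ.+<+ ()) }
  archimedean (mkℚ ℤ.-[1+ k ] d _) 0<x = contradiction (drop-*<* 0<x) λ ()

  -- The limiting density

  -- The factors `1ℚ` come from unfolding `_^_`: these are literally the terms of the numerator and
  -- denominator in `density`.
  num den : ℚ → ℚ
  num a = ι 2 * (a * (a * 1ℚ)) - a * (a * (a * 1ℚ))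
  den a = (1ℚ - a) + a * (a * 1ℚ)

  -- The recursion for blueProb is a geometric series with ratio a (1 - a) = 1 - den a.
  blueProb-closed : ∀ a t → blueProb a t * den a + (a - (1ℚ - a)) * pow (a * (1ℚ - a)) (suc t) ≡ num a
  blueProb-closed a zero = solve 1 (λ a →
    a :* ((con 1ℚ :- a) :+ a :* (a :* con 1ℚ)) :+ (a :- (con 1ℚ :- a)) :* ((a :* (con 1ℚ :- a)) :* con 1ℚ) :=
    con (ι 2) :* (a :* (a :* con 1ℚ)) :- a :* (a :* (a :* con 1ℚ))) refl a
  blueProb-closed a (suc t) = trans
    (solve 3 (λ a b q →
        (b :+ (a :* q :- (con 1ℚ :- a) :* q)) :* ((con 1ℚ :- a) :+ a :* (a :* con 1ℚ))
          :+ (a :- (con 1ℚ :- a)) :* ((a :* (con 1ℚ :- a)) :* q) :=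
        b :* ((con 1ℚ :- a) :+ a :* (a :* con 1ℚ)) :+ (a :- (con 1ℚ :- a)) :* q) refl
      a (blueProb a t) (pow (a * (1ℚ - a)) (suc t)))
    (blueProb-closed a t)

  ¼ ¾ : ℚ
  ¼ = ½ * ½
  ¾ = ½ + ¼

  pow-≥0 : ∀ {r} → 0ℚ ≤ r → ∀ t → 0ℚ ≤ pow r t
  pow-≥0 0≤r zero    = 0≤1
  pow-≥0 0≤r (suc t) = 0≤* 0≤r (pow-≥0 0≤r t)

  4^t*pow≤1 : ∀ {r} → 0ℚ ≤ r → r ≤ ¼ → ∀ t → ι (2 ℕ.^ t) * ι (2 ℕ.^ t) * pow r t ≤ 1ℚ
  4^t*pow≤1 0≤r r≤¼ zero = ≤-refl
  4^t*pow≤1 {r} 0≤r r≤¼ (suc t) = begin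
    ι (2 ℕ.^ suc t) * ι (2 ℕ.^ suc t) * (r * pow r t)
      ≡⟨ cong (λ x → x * x * (r * pow r t)) (ι-* 2 (2 ℕ.^ t)) ⟩
    ι 2 * x * (ι 2 * x) * (r * pow r t)
      ≡⟨ solve 3 (λ x r p → con (ι 2) :* x :* (con (ι 2) :* x) :* (r :* p) := (con (ι 4) :* r) :* (x :* x :* p)) refl x r (pow r t) ⟩
    (ι 4 * r) * (x * x * pow r t)
      ≤⟨ *-mono (0≤* (0≤ι 4) 0≤r) 0≤1 (*-monoˡ-≤-nonNeg (ι 4) r≤¼) (4^t*pow≤1 0≤r r≤¼ t) ⟩
    1ℚ ∎
    where
    open ≤-Reasoning
    x = ι (2 ℕ.^ t)

  module _ {a : ℚ} (½≤a : ½ ≤ a) (a≤1 : a ≤ 1ℚ) where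

    0≤a : 0ℚ ≤ a
    0≤a = ≤-trans (nonNegative⁻¹ ½) ½≤a

    0≤a[1-a] : 0ℚ ≤ a * (1ℚ - a)
    0≤a[1-a] = 0≤* 0≤a (0≤y-x a≤1)

    a[1-a]≤¼ : a * (1ℚ - a) ≤ ¼
    a[1-a]≤¼ = ≤-by ((a - ½) * (a - ½)) (0≤square (a - ½))
      (solve 1 (λ a → a :* (con 1ℚ :- a) :+ (a :- con ½) :* (a :- con ½) := con ¼) refl a)

    ¾≤den : ¾ ≤ den a
    ¾≤den = ≤-by ((a - ½) * (a - ½)) (0≤square (a - ½))
      (solve 1 (λ a → con ¾ :+ (a :- con ½) :* (a :- con ½) := (con 1ℚ :- a) :+ a :* (a :* con 1ℚ)) refl a)

    private instance
      den-pos : Positive (den a)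
      den-pos = positive (<-≤-trans (positive⁻¹ ¾) ¾≤den)

    -- A crude positive lower bound, uniform in `a`, which turns absolute errors into relative ones.
    ¼≤density : ∀ {D} → D * den a ≡ num a → ¼ ≤ D
    ¼≤density {D} eq = *-cancelʳ-≤-pos (den a) (begin
      ¼ * den a ≤⟨ ≤-by (¼ * (a * (1ℚ - a))) (0≤* (nonNegative⁻¹ ¼) 0≤a[1-a])
                     (solve 1 (λ a → con ¼ :* ((con 1ℚ :- a) :+ a :* (a :* con 1ℚ)) :+ con ¼ :* (a :* (con 1ℚ :- a)) := con ¼) refl a) ⟩
      -- Here `num a = a² + a² (1 - a)`, and `a² - ¼ = (a - ½) (a + ½)` is nonnegative by `½ ≤ a`.
      ¼         ≤⟨ ≤-by ((a * a) * (1ℚ - a) + (a - ½) * (a + ½))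
                     (0≤+ (0≤* (0≤square a) (0≤y-x a≤1)) (0≤* (0≤y-x ½≤a) (0≤+ 0≤a (nonNegative⁻¹ ½))))
                     (solve 1 (λ a → con ¼ :+ ((a :* a) :* (con 1ℚ :- a) :+ (a :- con ½) :* (a :+ con ½)) :=
                       con (ι 2) :* (a :* (a :* con 1ℚ)) :- a :* (a :* (a :* con 1ℚ))) refl a) ⟩
      num a     ≡⟨ eq ⟨
      D * den a ∎)
      where open ≤-Reasoning

    module _ {D : ℚ} (eq : D * den a ≡ num a) (t : ℕ) where
      private
        q = pow (a * (1ℚ - a)) (suc t)
        0≤q : 0ℚ ≤ q
        0≤q = pow-≥0 0≤a[1-a] (suc t)
        0≤a-[1-a] : 0ℚ ≤ a - (1ℚ - a)
        0≤a-[1-a] = subst (0ℚ ≤_) (solve 1 (λ a → (a :- con ½) :+ (a :- con ½) := a :- (con 1ℚ :- a)) refl a)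
          (0≤+ (0≤y-x ½≤a) (0≤y-x ½≤a))

      -- For `a ≥ ½` every increment of `blueProb` is nonnegative, so the limit is approached from
      -- below.
      blueProb≤density : blueProb a t ≤ D
      blueProb≤density = *-cancelʳ-≤-pos (den a)
        (≤-by ((a - (1ℚ - a)) * q) (0≤* 0≤a-[1-a] 0≤q) (trans (blueProb-closed a t) (sym eq)))

      density≤blueProb : ∀ {η} → q + q ≤ η → D ≤ blueProb a t + η
      density≤blueProb {η} 2q≤η = *-cancelʳ-≤-pos (den a) (begin
        D * den a
          ≡⟨ trans eq (sym (blueProb-closed a t)) ⟩
        B * den a + (a - (1ℚ - a)) * q
          ≤⟨ +-monoʳ-≤ (B * den a) (≤-trans bound (*-monoʳ-≤-nonNeg (den a) {{pos⇒nonNeg (den a)}} 2q≤η)) ⟩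
        B * den a + η * den a
          ≡⟨ *-distribʳ-+ (den a) B η ⟨
        (B + η) * den a ∎)
        where
        open ≤-Reasoning
        B = blueProb a t
        bound : (a - (1ℚ - a)) * q ≤ (q + q) * den a
        -- Behind this stands `a - (1 - a) ≤ 1 ≤ 2 * ¾ ≤ 2 * den a`.
        bound = ≤-by ((½ + (1ℚ - a) + (1ℚ - a)) * q + (den a - ¾) * (q + q))
          (0≤+ (0≤* (0≤+ (0≤+ (nonNegative⁻¹ ½) (0≤y-x a≤1)) (0≤y-x a≤1)) 0≤q) (0≤* (0≤y-x ¾≤den) (0≤+ 0≤q 0≤q)))
          (solve 3 (λ a q d → (a :- (con 1ℚ :- a)) :* q :+ ((con ½ :+ (con 1ℚ :- a) :+ (con 1ℚ :- a)) :* q :+ (d :- con ¾) :* (q :+ q)) :=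
            (q :+ q) :* d) refl a q (den a))

  -- The decidable event with rational thresholds

  _≟ᶜ_ : ∀ {n} (c c′ : Coloring n) → Dec (c ≡ c′)
  _≟ᶜ_ = ≡-dec _≟_

  ¬×₃ : ∀ {A B C : Set} → Dec A → Dec B → ¬ (A × B × C) → ¬ A ⊎ ¬ B ⊎ ¬ C
  ¬×₃ (no ¬a) _       _    = inj₁ ¬a
  ¬×₃ (yes _) (no ¬b) _    = inj₂ (inj₁ ¬b)
  ¬×₃ (yes a) (yes b) ¬abc = inj₂ (inj₂ (λ c → ¬abc (a , b , c)))

  module _ {n : ℕ} (3≤n : 3 ℕ.≤ n) (t : ℕ) (ρ η : ℚ) where
    open MM (cycle n 3≤n)

    -- The margin `ι 3 * η` has room for one `η` between `ρ` and the density, one between the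
    -- density and the probability of blue after `t` rounds, and one for the random deviation.
    Good : Coloring n → Set
    Good c = Stable (after t c) × (ρ - ι 3 * η) * ι n ≤ ι (blueCount (after t c))
                                × ι (blueCount (after t c)) ≤ (ρ + ι 3 * η) * ι n

    good? : ∀ c → Dec (Good c)
    good? c = (step (after t c) ≟ᶜ after t c) ×-dec
              ((ρ - ι 3 * η) * ι n ≤? ι (blueCount (after t c))) ×-dec
              (ι (blueCount (after t c)) ≤? (ρ + ι 3 * η) * ι n)

    -- Each of the two ways to fail costs `γ`. For instability, `n² q ≤ 1 ≤ n γ` gives `n q ≤ γ`.
    -- For the deviation, `M = η n` and the bound on `K * K` make the variance at most `γ M²`.
    good-likely : ∀ .{{_ : NonZero n}} {a γ D} → ½ ≤ a → a ≤ 1ℚ → 0ℚ < η → D * den a ≡ num a →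
      D ≤ ρ + η → ρ ≤ D + η → 3 ℕ.+ t ℕ.* 2 ℕ.≤ n →
      γ + γ ≤ η → 1ℚ ≤ ι n * γ → ι n * ι n * pow (a * (1ℚ - a)) (suc t) ≤ 1ℚ →
      (let K = ι (1 ℕ.+ t ℕ.* 2) in K * K ≤ ι n * (γ * (η * η))) →
      1ℚ ≤ E a (λ c → 𝟙 (does (good? c))) + (γ + γ)
    good-likely {a} {γ} {D} ½≤a a≤1 0<η D≡ D≤ ρ≤ 3+2t≤n 2γ≤η 1≤nγ nnq≤1 KK≤ =
      *-cancelˡ-≤-pos (M * M) (begin
        M * M * 1ℚ
          ≡⟨ *-identityʳ (M * M) ⟩
        M * M
          ≤⟨ concentration 3≤n t (0≤a ½≤a a≤1) a≤1 3+2t≤n (does ∘ good?) M cover ⟩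
        M * M * (P + ι n * q) + ι n * (K * K)
          ≤⟨ +-mono-≤ (*-monoˡ-≤-nonNeg (M * M) {{nonNegative (0≤square M)}} (+-monoʳ-≤ P nq≤γ))
                      (*-monoˡ-≤-nonNeg (ι n) {{nonNegative (0≤ι n)}} KK≤) ⟩
        M * M * (P + γ) + ι n * (ι n * (γ * (η * η)))
          ≡⟨ solve 4 (λ e n p g → (e :* n) :* (e :* n) :* (p :+ g) :+ n :* (n :* (g :* (e :* e))) :=
               (e :* n) :* (e :* n) :* (p :+ (g :+ g))) refl η (ι n) P γ ⟩
        M * M * (P + (γ + γ)) ∎)
      where
      open ≤-Reasoning
      K q P M B μ : ℚ
      K = ι (1 ℕ.+ t ℕ.* 2)
      q = pow (a * (1ℚ - a)) (suc t)
      P = E a (λ c → 𝟙 (does (good? c)))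
      M = η * ι n
      B = blueProb a t
      μ = ι n * B
      1≤n : 1ℚ ≤ ι n
      1≤n = ι-mono {1} (ℕ.≤-trans (ℕ.s≤s ℕ.z≤n) 3≤n)
      0<n : 0ℚ < ι n
      0<n = <-≤-trans (positive⁻¹ 1ℚ) 1≤n
      0<M : 0ℚ < M
      0<M = 0<* 0<η 0<n
      0≤q : 0ℚ ≤ q
      0≤q = pow-≥0 (0≤a[1-a] ½≤a a≤1) (suc t)
      instance
        M*M-pos : Positive (M * M)
        M*M-pos = positive (0<* 0<M 0<M)
      nq≤γ : ι n * q ≤ γ
      nq≤γ = *-cancelˡ-≤-pos (ι n) {{positive 0<n}}
        (≤-trans (≤-reflexive (sym (*-assoc (ι n) (ι n) q))) (≤-trans nnq≤1 1≤nγ))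
      q≤γ : q ≤ γ
      q≤γ = ≤-trans (≤-by ((ι n - 1ℚ) * q) (0≤* (0≤y-x 1≤n) 0≤q)
        (solve 2 (λ n q → q :+ (n :- con 1ℚ) :* q := n :* q) refl (ι n) q)) nq≤γ
      B≤ : B ≤ ρ + η
      B≤ = ≤-trans (blueProb≤density ½≤a a≤1 D≡ t) D≤
      ≤B : ρ ≤ (B + η) + η
      ≤B = ≤-trans ρ≤ (+-monoˡ-≤ η (density≤blueProb ½≤a a≤1 {D} D≡ t (≤-trans (+-mono-≤ q≤γ q≤γ) 2γ≤η)))
      0≤n = 0≤ι n
      -M≤M : - M ≤ M
      -M≤M = ≤-trans (neg-antimono-≤ (<⇒≤ 0<M)) (<⇒≤ 0<M)
      far-below : ∀ {F} → F ≤ (ρ - ι 3 * η) * ι n → M * M ≤ (F - μ) * (F - μ)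
      far-below {F} F≤ = ≤-trans (square-≤ M≤ (≤-trans -M≤M M≤))
        (≤-reflexive (solve 2 (λ x y → (y :- x) :* (y :- x) := (x :- y) :* (x :- y)) refl F μ))
        where
        M≤ : M ≤ μ - F
        -- Of the margin `3 η`, the gap between `ρ` and `B` uses up at most `2 η`.
        M≤ = ≤-by (((ρ - ι 3 * η) * ι n - F) + (((B + η) + η) - ρ) * ι n)
          (0≤+ (0≤y-x F≤) (0≤* (0≤y-x ≤B) 0≤n))
          (solve 5 (λ e n f r b → e :* n :+ (((r :- con (ι 3) :* e) :* n :- f) :+ (((b :+ e) :+ e) :- r) :* n) := n :* b :- f) refl
            η (ι n) F ρ B)
      far-above : ∀ {F} → (ρ + ι 3 * η) * ι n ≤ F → M * M ≤ (F - μ) * (F - μ)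
      far-above {F} ≤F = square-≤ M≤ (≤-trans -M≤M M≤)
        where
        M≤ : M ≤ F - μ
        -- Since `B` stays below the density, only one `η` is lost on this side, and the last
        -- summand is the surplus.
        M≤ = ≤-by ((F - (ρ + ι 3 * η) * ι n) + ((ρ + η) - B) * ι n + η * ι n)
          (0≤+ (0≤+ (0≤y-x ≤F) (0≤* (0≤y-x B≤) 0≤n)) (<⇒≤ 0<M))
          (solve 5 (λ e n f r b → e :* n :+ ((f :- (r :+ con (ι 3) :* e) :* n) :+ ((r :+ e) :- b) :* n :+ e :* n) := f :- n :* b) refl
            η (ι n) F ρ B)
      cover : ∀ c → does (good? c) ≡ true ⊎ step (after t c) ≢ after t c ⊎
                    M * M ≤ (blues 3≤n t c - μ) * (blues 3≤n t c - μ)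
      cover c = go (good? c)
        where
        F = blues 3≤n t c
        go : (g : Dec (Good c)) →
             does g ≡ true ⊎ step (after t c) ≢ after t c ⊎ M * M ≤ (F - μ) * (F - μ)
        go (yes _) = inj₁ refl
        go (no ¬g) = inj₂ (⊎.map₂
          ⊎.[ (λ ≰ → far-below (<⇒≤ (≰⇒> ≰))) , (λ ≰ → far-above (<⇒≤ (≰⇒> ≰))) ]
          (¬×₃ (step (after t c) ≟ᶜ after t c) ((ρ - ι 3 * η) * ι n ≤? F) ¬g))

  n²*pow≤1 : ∀ {a} → ½ ≤ a → a ≤ 1ℚ → ∀ n → ι n * ι n * pow (a * (1ℚ - a)) (suc ⌊log₂ n ⌋) ≤ 1ℚ
  n²*pow≤1 {a} ½≤a a≤1 n = ≤-trans
    (*-monoʳ-≤-nonNeg (pow (a * (1ℚ - a)) (suc ⌊log₂ n ⌋))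
      {{nonNegative (pow-≥0 (0≤a[1-a] ½≤a a≤1) (suc ⌊log₂ n ⌋))}}
      (*-mono (0≤ι n) (0≤ι (2 ℕ.^ suc ⌊log₂ n ⌋)) n≤ n≤))
    (4^t*pow≤1 (0≤a[1-a] ½≤a a≤1) (a[1-a]≤¼ ½≤a a≤1) (suc ⌊log₂ n ⌋))
    where
    n≤ : ι n ≤ ι (2 ℕ.^ suc ⌊log₂ n ⌋)
    n≤ = ι-mono (ℕ.<⇒≤ (n<2^[1+⌊log₂n⌋] n))

  -- A single use of `log²-sublinear`: the summands of `3 + (m₁ + m₂)` pay for the three conclusions
  -- in turn.
  eventually-large : ∀ {γ ζ} → 0ℚ < γ → 0ℚ < ζ → ∃[ N ] (∀ n → N ℕ.≤ n →
    let t = ⌊log₂ n ⌋ ; K = ι (1 ℕ.+ t ℕ.* 2) in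
    3 ℕ.+ t ℕ.* 2 ℕ.≤ n × 1ℚ ≤ ι n * γ × K * K ≤ ι n * ζ)
  eventually-large {γ} {ζ} 0<γ 0<ζ =
    let m₁ , 1≤m₁γ = archimedean γ 0<γ
        m₂ , 1≤m₂ζ = archimedean ζ 0<ζ
        N , bound = log²-sublinear (3 ℕ.+ (m₁ ℕ.+ m₂))
    in N , λ n N≤n → large m₁ m₂ n (bound n N≤n) 1≤m₁γ 1≤m₂ζ
    where
    large : ∀ m₁ m₂ n → let t = ⌊log₂ n ⌋ ; k = 1 ℕ.+ t ℕ.* 2 in
      (3 ℕ.+ (m₁ ℕ.+ m₂)) ℕ.* (k ℕ.* k) ℕ.≤ n → 1ℚ ≤ ι m₁ * γ → 1ℚ ≤ ι m₂ * ζ →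
      3 ℕ.+ t ℕ.* 2 ℕ.≤ n × 1ℚ ≤ ι n * γ × ι k * ι k ≤ ι n * ζ
    large m₁ m₂ n bound 1≤m₁γ 1≤m₂ζ =
        ℕ.≤-trans 2+k≤3kk (ℕ.≤-trans (ℕ.*-monoˡ-≤ kk (ℕ.m≤m+n 3 (m₁ ℕ.+ m₂))) bound)
      , ≤-trans 1≤m₁γ (*-monoʳ-≤-nonNeg γ {{nonNegative (<⇒≤ 0<γ)}} (ι-mono
          (ℕ.≤-trans (ℕ.m≤m*n m₁ kk) (ℕ.≤-trans (ℕ.*-monoˡ-≤ kk
            (ℕ.≤-trans (ℕ.m≤m+n m₁ m₂) (ℕ.m≤n+m (m₁ ℕ.+ m₂) 3))) bound))))
      , (begin
          ι k * ι k               ≡⟨ *-identityʳ (ι k * ι k) ⟨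
          ι k * ι k * 1ℚ          ≤⟨ *-monoˡ-≤-nonNeg (ι k * ι k) {{nonNegative (0≤square (ι k))}} 1≤m₂ζ ⟩
          ι k * ι k * (ι m₂ * ζ)  ≡⟨ solve 3 (λ x y z → x :* (y :* z) := (y :* x) :* z) refl (ι k * ι k) (ι m₂) ζ ⟩
          ι m₂ * (ι k * ι k) * ζ  ≡⟨ cong (_* ζ) (trans (ι-* m₂ kk) (cong (ι m₂ *_) (ι-* k k))) ⟨
          ι (m₂ ℕ.* kk) * ζ       ≤⟨ *-monoʳ-≤-nonNeg ζ {{nonNegative (<⇒≤ 0<ζ)}} (ι-mono
                                       (ℕ.≤-trans (ℕ.*-monoˡ-≤ kk (ℕ.≤-trans (ℕ.m≤n+m m₂ m₁) (ℕ.m≤n+m (m₁ ℕ.+ m₂) 3))) bound)) ⟩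
          ι n * ζ ∎)
      where
      open ≤-Reasoning
      k kk : ℕ
      k = 1 ℕ.+ ⌊log₂ n ⌋ ℕ.* 2
      kk = k ℕ.* k
      2+k≤3kk : 2 ℕ.+ k ℕ.≤ 3 ℕ.* kk
      2+k≤3kk = ℕ.≤-trans
        (ℕ.≤-trans (ℕ.≤-reflexive (ℕ.+-comm 2 k)) (ℕ.+-monoʳ-≤ k (ℕ.+-mono-≤ {1} {k} (ℕ.s≤s ℕ.z≤n) (ℕ.+-mono-≤ {1} {k} (ℕ.s≤s ℕ.z≤n) (ℕ.z≤n {0})))))
        (ℕ.*-monoʳ-≤ 3 (ℕ.m≤m*n k k))

  -- `N` depends on `η` and `γ` alone. This uniformity allows `a` and `D` to run through the terms
  -- of real sequences while `n` stays fixed.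
  good-likely-log : ∀ {η γ} → 0ℚ < η → 0ℚ < γ → γ + γ ≤ η →
    ∃[ N ] (∀ n (3≤n : 3 ℕ.≤ n) → N ℕ.≤ n → ∀ {a D ρ} → ½ ≤ a → a ≤ 1ℚ →
      D * den a ≡ num a → D ≤ ρ + η → ρ ≤ D + η →
      1ℚ ≤ E a (λ c → 𝟙 (does (good? 3≤n ⌊log₂ n ⌋ ρ η c))) + (γ + γ))
  good-likely-log {η} {γ} 0<η 0<γ 2γ≤η =
    let N , large = eventually-large 0<γ (0<* 0<γ (0<* 0<η 0<η))
    in N , λ n 3≤n N≤n {a} {D} {ρ} ½≤a a≤1 eq D≤ ρ≤ →
      let 3+2t≤n , 1≤nγ , KK≤ = large n N≤n
      in good-likely 3≤n ⌊log₂ n ⌋ ρ η {{ℕ.>-nonZero (ℕ.≤-trans (ℕ.s≤s ℕ.z≤n) 3≤n)}}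
           ½≤a a≤1 0<η eq D≤ ρ≤ 3+2t≤n 2γ≤η 1≤nγ (n²*pow≤1 ½≤a a≤1 n) KK≤

  -- Here ε is at least 32 η and D is at least ¼, so ε D ≥ 8 η absorbs the
  -- deviations η of D from ρ and 3 η of the number of blue nodes.
  module _ {η ε D ρ : ℚ} (0≤η : 0ℚ ≤ η) (32η≤ε : ι 32 * η ≤ ε) (¼≤D : ¼ ≤ D) where
    private
      slack : 0ℚ ≤ (ε - ι 32 * η) * D + (ι 32 * η) * (D - ¼) + ι 4 * η
      slack = 0≤+ (0≤+ (0≤* (0≤y-x 32η≤ε) (≤-trans (nonNegative⁻¹ ¼) ¼≤D))
                       (0≤* (0≤* (0≤ι 32) 0≤η) (0≤y-x ¼≤D))) (0≤* (0≤ι 4) 0≤η)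

    relative-lower : D ≤ ρ + η → (1ℚ - ε) * D ≤ ρ - ι 3 * η
    relative-lower D≤ = ≤-by ((ρ + η - D) + ((ε - ι 32 * η) * D + (ι 32 * η) * (D - ¼) + ι 4 * η))
      (0≤+ (0≤y-x D≤) slack)
      (solve 4 (λ h e d r → (con 1ℚ :- e) :* d :+ ((r :+ h :- d) :+
          ((e :- con (ι 32) :* h) :* d :+ (con (ι 32) :* h) :* (d :- con ¼) :+ con (ι 4) :* h)) :=
          r :- con (ι 3) :* h) refl η ε D ρ)

    relative-upper : ρ ≤ D + η → ρ + ι 3 * η ≤ (1ℚ + ε) * D
    relative-upper ρ≤ = ≤-by ((D + η - ρ) + ((ε - ι 32 * η) * D + (ι 32 * η) * (D - ¼) + ι 4 * η))
      (0≤+ (0≤y-x ρ≤) slack)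
      (solve 4 (λ h e d r → (r :+ con (ι 3) :* h) :+ ((d :+ h :- r) :+
          ((e :- con (ι 32) :* h) :* d :+ (con (ι 32) :* h) :* (d :- con ¼) :+ con (ι 4) :* h)) :=
          (con 1ℚ :+ e) :* d) refl η ε D ρ)

  -- Sequences with the same limit

  abs-≤ : ∀ {x e} → x ≤ e → - x ≤ e → ∣ x ∣ ≤ e
  abs-≤ {x} x≤e -x≤e with ∣p∣≡p∨∣p∣≡-p x
  ... | inj₁ eq = subst (_≤ _) (sym eq) x≤e
  ... | inj₂ eq = subst (_≤ _) (sym eq) -x≤e

  x≤∣x∣ : ∀ x → x ≤ ∣ x ∣
  x≤∣x∣ x with ≤-total 0ℚ x
  ... | inj₁ 0≤x = ≤-reflexive (sym (0≤p⇒∣p∣≡p 0≤x))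
  ... | inj₂ x≤0 = ≤-trans x≤0 (0≤∣p∣ x)

  ∣x-y∣≡∣y-x∣ : ∀ x y → ∣ x - y ∣ ≡ ∣ y - x ∣
  ∣x-y∣≡∣y-x∣ x y = trans (cong ∣_∣ (solve 2 (λ x y → x :- y := :- (y :- x)) refl x y)) (∣-p∣≡∣p∣ (y - x))

  ∣x-y∣≤e⇒x≤y+e : ∀ x y {e} → ∣ x - y ∣ ≤ e → x ≤ y + e
  ∣x-y∣≤e⇒x≤y+e x y {e} h = ≤-by (e - (x - y)) (0≤y-x (≤-trans (x≤∣x∣ (x - y)) h))
    (solve 3 (λ x y e → x :+ (e :- (x :- y)) := y :+ e) refl x y e)

  ∣x-z∣≤∣x-y∣+∣y-z∣ : ∀ x y z → ∣ x - z ∣ ≤ ∣ x - y ∣ + ∣ y - z ∣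
  ∣x-z∣≤∣x-y∣+∣y-z∣ x y z = subst (λ w → ∣ w ∣ ≤ ∣ x - y ∣ + ∣ y - z ∣)
    (solve 3 (λ x y z → (x :- y) :+ (y :- z) := x :- z) refl x y z) (∣p+q∣≤∣p∣+∣q∣ (x - y) (y - z))

  half-pos : ∀ {ε} → 0ℚ < ε → 0ℚ < ½ * ε
  half-pos = 0<* (positive⁻¹ ½)

  half+half : ∀ ε → ½ * ε + ½ * ε ≡ ε
  half+half = solve 1 (λ e → con ½ :* e :+ con ½ :* e := e) refl

  half-min : ∀ {x y} → 0ℚ < x → 0ℚ < y → ∃[ z ] (0ℚ < z × z + z ≤ x × z + z ≤ y)
  half-min {x} {y} 0<x 0<y with ≤-total x y
  ... | inj₁ x≤y = ½ * x , half-pos 0<x , ≤-reflexive (half+half x) , ≤-trans (≤-reflexive (half+half x)) x≤y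
  ... | inj₂ y≤x = ½ * y , half-pos 0<y , ≤-trans (≤-reflexive (half+half y)) y≤x , ≤-reflexive (half+half y)

  divide : ∀ M {ε} → 0ℚ < M → 0ℚ < ε → ∃[ ζ ] (0ℚ < ζ × M * ζ ≡ ε)
  divide M {ε} 0<M 0<ε = (1/ M) * ε , 0<* (positive⁻¹ (1/ M) {{1/pos⇒pos M}}) 0<ε ,
    trans (sym (*-assoc M (1/ M) ε)) (trans (cong (_* ε) (*-inverseʳ M)) (*-identityˡ ε))
    where
    instance
      M-pos = positive 0<M
      M≢0   = pos⇒nonZero M

  infix 4 _≈_
  record _≈_ (s t : ℕ → ℚ) : Set where
    field
      eventually : ∀ ε → 0ℚ < ε → ∃[ N ] (∀ k → N ℕ.≤ k → ∣ s k - t k ∣ ≤ ε)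
  open _≈_ public

  ≈-pointwise : ∀ {s t} → (∀ k → s k ≡ t k) → s ≈ t
  ≈-pointwise {s} {t} eq .eventually ε 0<ε = 0 , λ k _ →
    subst (λ z → ∣ z ∣ ≤ ε) (sym (trans (cong (_- t k) (eq k)) (+-inverseʳ (t k)))) (<⇒≤ 0<ε)

  ≈-sym : ∀ {s t} → s ≈ t → t ≈ s
  ≈-sym {s} {t} h .eventually ε 0<ε = let N , close = eventually h ε 0<ε in
    N , λ k N≤k → subst (_≤ ε) (∣x-y∣≡∣y-x∣ (s k) (t k)) (close k N≤k)

  ≈-trans : ∀ {s t u} → s ≈ t → t ≈ u → s ≈ u
  ≈-trans {s} {t} {u} h h′ .eventually ε 0<ε =
    let N , close = eventually h (½ * ε) (half-pos 0<ε)
        N′ , close′ = eventually h′ (½ * ε) (half-pos 0<ε)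
    in N ℕ.⊔ N′ , λ k N≤k → ≤-trans (∣x-z∣≤∣x-y∣+∣y-z∣ (s k) (t k) (u k))
         (subst (∣ s k - t k ∣ + ∣ t k - u k ∣ ≤_) (half+half ε)
           (+-mono-≤ (close k (ℕ.m⊔n≤o⇒m≤o N N′ N≤k)) (close′ k (ℕ.m⊔n≤o⇒n≤o N N′ N≤k))))

  ≈-+ : ∀ {s s′ t t′} → s ≈ s′ → t ≈ t′ → (λ k → s k + t k) ≈ (λ k → s′ k + t′ k)
  ≈-+ {s} {s′} {t} {t′} h h′ .eventually ε 0<ε =
    let N , close = eventually h (½ * ε) (half-pos 0<ε)
        N′ , close′ = eventually h′ (½ * ε) (half-pos 0<ε)
    in N ℕ.⊔ N′ , λ k N≤k → subst₂ (λ z e → ∣ z ∣ ≤ e)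
         (solve 4 (λ a a′ b b′ → (a :- a′) :+ (b :- b′) := (a :+ b) :- (a′ :+ b′)) refl (s k) (s′ k) (t k) (t′ k))
         (half+half ε)
         (≤-trans (∣p+q∣≤∣p∣+∣q∣ (s k - s′ k) (t k - t′ k))
           (+-mono-≤ (close k (ℕ.m⊔n≤o⇒m≤o N N′ N≤k)) (close′ k (ℕ.m⊔n≤o⇒n≤o N N′ N≤k))))

  ≈-neg : ∀ {s t} → s ≈ t → (λ k → - s k) ≈ (λ k → - t k)
  ≈-neg {s} {t} h .eventually ε 0<ε = let N , close = eventually h ε 0<ε in
    N , λ k N≤k → subst (_≤ ε)
      (trans (∣x-y∣≡∣y-x∣ (s k) (t k))
        (cong ∣_∣ (solve 2 (λ x y → y :- x := (:- x) :- (:- y)) refl (s k) (t k)))) (close k N≤k)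

  cauchy-bounded : ∀ {s} → Cauchy s → ∃[ B ] (0ℚ < B × ∃[ N ] (∀ k → N ℕ.≤ k → ∣ s k ∣ ≤ B))
  cauchy-bounded {s} c with c 1ℚ (positive⁻¹ 1ℚ)
  ... | N , h = 1ℚ + ∣ s N ∣ , <-≤-trans (positive⁻¹ 1ℚ) (≤-by ∣ s N ∣ (0≤∣p∣ (s N)) refl) , N , λ k N≤k →
    ≤-trans (subst (λ z → ∣ z ∣ ≤ ∣ s k - s N ∣ + ∣ s N ∣)
               (solve 2 (λ a b → (a :- b) :+ b := a) refl (s k) (s N)) (∣p+q∣≤∣p∣+∣q∣ (s k - s N) (s N)))
      (+-monoˡ-≤ ∣ s N ∣ (h k N N≤k ℕ.≤-refl))

  -- The splitting `a b - a′ b′ = a (b - b′) + b′ (a - a′)` needs bounds on one old and one new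
  -- factor, hence the choice of Cauchy hypotheses.
  ≈-* : ∀ {s s′ t t′} → Cauchy s → Cauchy t′ → s ≈ s′ → t ≈ t′ →
        (λ k → s k * t k) ≈ (λ k → s′ k * t′ k)
  ≈-* {s} {s′} {t} {t′} cs ct′ h h′ .eventually ε 0<ε =
    let A , 0<A , Nₐ , s≤A   = cauchy-bounded cs
        B , 0<B , Nᵦ , t′≤B  = cauchy-bounded ct′
        ζ , 0<ζ , [A+B]ζ≡ε   = divide (A + B) (+-mono-< 0<A 0<B) 0<ε
        N , close            = eventually h ζ 0<ζ
        N′ , close′          = eventually h′ ζ 0<ζ
        left  : ∀ {k} → (Nₐ ℕ.⊔ Nᵦ) ℕ.⊔ (N ℕ.⊔ N′) ℕ.≤ k → Nₐ ℕ.⊔ Nᵦ ℕ.≤ k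
        left  = ℕ.m⊔n≤o⇒m≤o (Nₐ ℕ.⊔ Nᵦ) (N ℕ.⊔ N′)
        right : ∀ {k} → (Nₐ ℕ.⊔ Nᵦ) ℕ.⊔ (N ℕ.⊔ N′) ℕ.≤ k → N ℕ.⊔ N′ ℕ.≤ k
        right = ℕ.m⊔n≤o⇒n≤o (Nₐ ℕ.⊔ Nᵦ) (N ℕ.⊔ N′)
    in (Nₐ ℕ.⊔ Nᵦ) ℕ.⊔ (N ℕ.⊔ N′) , λ k N≤k →
      subst (∣ s k * t k - s′ k * t′ k ∣ ≤_) [A+B]ζ≡ε
        (product A B ζ (<⇒≤ 0<ζ) (s k) (s′ k) (t k) (t′ k)
          (s≤A k (ℕ.m⊔n≤o⇒m≤o Nₐ Nᵦ (left N≤k))) (t′≤B k (ℕ.m⊔n≤o⇒n≤o Nₐ Nᵦ (left N≤k)))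
          (close k (ℕ.m⊔n≤o⇒m≤o N N′ (right N≤k))) (close′ k (ℕ.m⊔n≤o⇒n≤o N N′ (right N≤k))))
    where
    open ≤-Reasoning
    product : ∀ A B ζ → 0ℚ ≤ ζ → ∀ a a′ b b′ → ∣ a ∣ ≤ A → ∣ b′ ∣ ≤ B →
              ∣ a - a′ ∣ ≤ ζ → ∣ b - b′ ∣ ≤ ζ → ∣ a * b - a′ * b′ ∣ ≤ (A + B) * ζ
    product A B ζ 0≤ζ a a′ b b′ a≤A b′≤B a-a′≤ζ b-b′≤ζ = begin
      ∣ a * b - a′ * b′ ∣
        ≡⟨ cong ∣_∣ (solve 4 (λ a a′ b b′ → a :* b :- a′ :* b′ := a :* (b :- b′) :+ b′ :* (a :- a′)) refl a a′ b b′) ⟩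
      ∣ a * (b - b′) + b′ * (a - a′) ∣
        ≤⟨ ∣p+q∣≤∣p∣+∣q∣ (a * (b - b′)) (b′ * (a - a′)) ⟩
      ∣ a * (b - b′) ∣ + ∣ b′ * (a - a′) ∣
        ≡⟨ cong₂ _+_ (∣p*q∣≡∣p∣*∣q∣ a (b - b′)) (∣p*q∣≡∣p∣*∣q∣ b′ (a - a′)) ⟩
      ∣ a ∣ * ∣ b - b′ ∣ + ∣ b′ ∣ * ∣ a - a′ ∣
        ≤⟨ +-mono-≤ (*-mono (0≤∣p∣ a) 0≤ζ a≤A b-b′≤ζ) (*-mono (0≤∣p∣ b′) 0≤ζ b′≤B a-a′≤ζ) ⟩
      A * ζ + B * ζ
        ≡⟨ *-distribʳ-+ ζ A B ⟨
      (A + B) * ζ ∎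

  -- Makes the clamped sequence a real number. The error is split as `¼ + ½ + ¼`, with the outer
  -- parts for passing between `t` and `s`.
  ≈-cauchy : ∀ {s t} → s ≈ t → Cauchy s → Cauchy t
  ≈-cauchy {s} {t} h c ε 0<ε =
    let N , close = eventually h ¼ε 0<¼ε
        M , cauchy = c (½ * ε) (half-pos 0<ε)
        bound : ∀ m n → N ℕ.⊔ M ℕ.≤ m → N ℕ.⊔ M ℕ.≤ n → ∣ t m - t n ∣ ≤ ¼ε + (½ * ε + ¼ε)
        bound m n N≤m N≤n = ≤-trans (∣x-z∣≤∣x-y∣+∣y-z∣ (t m) (s m) (t n))
          (+-mono-≤ (subst (_≤ ¼ε) (∣x-y∣≡∣y-x∣ (s m) (t m)) (close m (ℕ.m⊔n≤o⇒m≤o N M N≤m)))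
            (≤-trans (∣x-z∣≤∣x-y∣+∣y-z∣ (s m) (s n) (t n))
              (+-mono-≤ (cauchy m n (ℕ.m⊔n≤o⇒n≤o N M N≤m) (ℕ.m⊔n≤o⇒n≤o N M N≤n))
                (close n (ℕ.m⊔n≤o⇒m≤o N M N≤n)))))
    in N ℕ.⊔ M , λ m n N≤m N≤n → subst (∣ t m - t n ∣ ≤_)
         (solve 1 (λ e → con ½ :* (con ½ :* e) :+ (con ½ :* e :+ con ½ :* (con ½ :* e)) := e) refl ε)
         (bound m n N≤m N≤n)
    where
    ¼ε : ℚ
    ¼ε = ½ * (½ * ε)
    0<¼ε : 0ℚ < ¼ε
    0<¼ε = half-pos (half-pos 0<ε)

  -- Clamping the parameter to [½, 1]

  clamp : ℚ → ℚ
  clamp x = ½ ⊔ (x ⊓ 1ℚ)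

  ½≤clamp : ∀ x → ½ ≤ clamp x
  ½≤clamp x = p≤p⊔q ½ (x ⊓ 1ℚ)

  clamp≤1 : ∀ x → clamp x ≤ 1ℚ
  clamp≤1 x = ⊔-lub (≤ᵇ⇒≤ {½} {1ℚ} tt) (p⊓q≤q x 1ℚ)

  -- The two bounds on `x` have the form in which `½ℝ ≤ p` and `p ≤ 1ℝ` constrain the terms of `p`.
  clamp-close : ∀ x {e} → 0ℚ ≤ e → ½ ≤ x + e → x ≤ 1ℚ + e → ∣ x - clamp x ∣ ≤ e
  clamp-close x {e} 0≤e lower upper = abs-≤
    (≤-by (clamp x + e - x) (0≤y-x below) (solve 3 (λ x c e → (x :- c) :+ (c :+ e :- x) := e) refl x (clamp x) e))
    (≤-by (x + e - clamp x) (0≤y-x above) (solve 3 (λ x c e → :- (x :- c) :+ (x :+ e :- c) := e) refl x (clamp x) e))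
    where
    x≤x+e : x ≤ x + e
    x≤x+e = ≤-by e 0≤e refl
    above : clamp x ≤ x + e
    above = ⊔-lub lower (≤-trans (p⊓q≤p x 1ℚ) x≤x+e)
    below : x ≤ clamp x + e
    below with ≤-total x 1ℚ
    ... | inj₁ x≤1 = ≤-trans x≤x+e (+-monoˡ-≤ e (≤-trans (≤-reflexive (sym (p≤q⇒p⊓q≡p x≤1))) (p≤q⊔p ½ (x ⊓ 1ℚ))))
    ... | inj₂ 1≤x = ≤-trans upper (+-monoˡ-≤ e (≤-trans (≤-reflexive (sym (p≥q⇒p⊓q≡q 1≤x))) (p≤q⊔p ½ (x ⊓ 1ℚ))))

-- Transfer to real numbers

open import Defs
open ℚSolver.+-*-Solver using (solve; _:=_; _:+_; _:*_; _:-_; con)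

infix 4 _≃_
_≃_ : ℝ → ℝ → Set
x ≃ y = seq x ≈ seq y

≃-refl : ∀ {x} → x ≃ x
≃-refl = ≈-pointwise (λ _ → refl)

+-cong : ∀ {x x′ y y′} → x ≃ x′ → y ≃ y′ → x + y ≃ x′ + y′
+-cong = ≈-+

*-cong : ∀ {x x′ y y′} → x ≃ x′ → y ≃ y′ → x * y ≃ x′ * y′
*-cong {x} {y′ = y′} = ≈-* (cauchy x) (cauchy y′)

neg-cong : ∀ {x y} → x ≃ y → - x ≃ - y
neg-cong = ≈-neg

^-cong : ∀ {x y} n → x ≃ y → x ^ n ≃ y ^ n
^-cong zero    h = ≃-refl {1ℝ}
^-cong {x} {y} (suc n) h = *-cong {x} {y} {x ^ n} {y ^ n} h (^-cong {x} {y} n h)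

≤-respʳ : ∀ {x y z} → y ≃ z → x ≤ y → x ≤ z
≤-respʳ {x} {y} {z} h x≤y ε 0<ε =
  let N , close = eventually h (½ ℚ.* ε) (half-pos 0<ε)
      M , le    = x≤y (½ ℚ.* ε) (half-pos 0<ε)
  in N ℕ.⊔ M , λ k N≤k → ℚ.≤-trans (le k (ℕ.m⊔n≤o⇒n≤o N M N≤k))
    (ℚ.≤-trans (ℚ.+-monoˡ-≤ (½ ℚ.* ε) (∣x-y∣≤e⇒x≤y+e (seq y k) (seq z k) (close k (ℕ.m⊔n≤o⇒m≤o N M N≤k))))
      (ℚ.≤-reflexive (trans (ℚ.+-assoc (seq z k) (½ ℚ.* ε) (½ ℚ.* ε)) (cong (seq z k ℚ.+_) (half+half ε)))))

≤-respˡ : ∀ {x y z} → x ≃ y → x ≤ z → y ≤ z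
≤-respˡ {x} {y} {z} h x≤z ε 0<ε =
  let N , close = eventually (≈-sym h) (½ ℚ.* ε) (half-pos 0<ε)
      M , le    = x≤z (½ ℚ.* ε) (half-pos 0<ε)
  in N ℕ.⊔ M , λ k N≤k → ℚ.≤-trans (∣x-y∣≤e⇒x≤y+e (seq y k) (seq x k) (close k (ℕ.m⊔n≤o⇒m≤o N M N≤k)))
    (ℚ.≤-trans (ℚ.+-monoˡ-≤ (½ ℚ.* ε) (le k (ℕ.m⊔n≤o⇒n≤o N M N≤k)))
      (ℚ.≤-reflexive (trans (ℚ.+-assoc (seq z k) (½ ℚ.* ε) (½ ℚ.* ε)) (cong (seq z k ℚ.+_) (half+half ε)))))

-- The density as a function of the real parameter

recip-inverse : ∀ x (0<x : 0ℝ < x) k → proj₁ (proj₂ (proj₂ 0<x)) ℕ.≤ k →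
                seq (recip x 0<x) k ℚ.* seq x k ≡ 1ℚ
recip-inverse x (ε , 0<ε , N , 0+ε≤x) k N≤k =
  subst (λ z → 1/⊔ 0<ε (seq x k) ℚ.* z ≡ 1ℚ)
    (ℚ.p≤q⇒p⊔q≡q (subst (ℚ._≤ seq x k) (ℚ.+-identityˡ ε) (0+ε≤x k N≤k)))
    (ℚ.*-inverseˡ (ε ℚ.⊔ seq x k) {{ℚ.pos⇒nonZero (ε ℚ.⊔ seq x k) {{⊔-pos 0<ε (seq x k)}}}})

recip-den : ℝ → ℝ
recip-den p = recip (1ℝ - p + p ^ 2) (0<1-p+p² p)

-- Holds at every index because `0<1-p+p²` has the bound ¾ from index 0 on.
recip-den-inverse : ∀ p k → seq (recip-den p) k ℚ.* den (seq p k) ≡ 1ℚ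
recip-den-inverse p k = recip-inverse (1ℝ - p + p ^ 2) (0<1-p+p² p) k ℕ.z≤n

-- Exact at each term, so `seq (density p) k` can serve as the rational density `D` for
-- `a = seq p k`.
density-equation : ∀ p k → seq (density p) k ℚ.* den (seq p k) ≡ num (seq p k)
density-equation p k = trans (ℚ.*-assoc (num (seq p k)) (seq (recip-den p) k) (den (seq p k)))
  (trans (cong (num (seq p k) ℚ.*_) (recip-den-inverse p k)) (ℚ.*-identityʳ (num (seq p k))))

den-cong : ∀ {p p′} → p ≃ p′ → 1ℝ - p + p ^ 2 ≃ 1ℝ - p′ + p′ ^ 2
den-cong {p} {p′} h = +-cong {1ℝ - p} {1ℝ - p′} {p ^ 2} {p′ ^ 2}
  (+-cong {1ℝ} {1ℝ} { - p} { - p′} (≃-refl {1ℝ}) (neg-cong {p} {p′} h)) (^-cong {p} {p′} 2 h)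

-- 1/x = (1/x)(1/y) y ≃ (1/x)(1/y) x = 1/y for x ≃ y.
recip-den-cong : ∀ {p p′} → p ≃ p′ → recip-den p ≃ recip-den p′
recip-den-cong {p} {p′} h = ≈-trans (≈-pointwise left) (≈-trans
  (*-cong {x * y} {x * y} {Y} {X} (≃-refl {x * y}) (den-cong {p′} {p} (≈-sym h))) (≈-pointwise right))
  where
  x y X Y : ℝ
  x = recip-den p
  y = recip-den p′
  X = 1ℝ - p + p ^ 2
  Y = 1ℝ - p′ + p′ ^ 2
  left : ∀ k → seq x k ≡ seq x k ℚ.* seq y k ℚ.* seq Y k
  left k = sym (trans (ℚ.*-assoc (seq x k) (seq y k) (seq Y k))
    (trans (cong (seq x k ℚ.*_) (recip-den-inverse p′ k)) (ℚ.*-identityʳ (seq x k))))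
  right : ∀ k → seq x k ℚ.* seq y k ℚ.* seq X k ≡ seq y k
  right k = trans (solve 3 (λ x y z → x :* y :* z := (x :* z) :* y) refl (seq x k) (seq y k) (seq X k))
    (trans (cong (ℚ._* seq y k) (recip-den-inverse p k)) (ℚ.*-identityˡ (seq y k)))

density-cong : ∀ {p p′} → p ≃ p′ → density p ≃ density p′
density-cong {p} {p′} h = *-cong {2ℝ * p ^ 2 - p ^ 3} {2ℝ * p′ ^ 2 - p′ ^ 3} {recip-den p} {recip-den p′}
  (+-cong {2ℝ * p ^ 2} {2ℝ * p′ ^ 2} { - p ^ 3} { - p′ ^ 3}
    (*-cong {2ℝ} {2ℝ} {p ^ 2} {p′ ^ 2} (≃-refl {2ℝ}) (^-cong {p} {p′} 2 h))
    (neg-cong {p ^ 3} {p′ ^ 3} (^-cong {p} {p′} 3 h)))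
  (recip-den-cong {p} {p′} h)

weight-cong : ∀ {p p′ n} → p ≃ p′ → (c : Coloring n) → weight p c ≃ weight p′ c
weight-cong h [] = ≃-refl {1ℝ}
weight-cong {p} {p′} h (blue ∷ c) =
  *-cong {p} {p′} {weight p c} {weight p′ c} h (weight-cong {p} {p′} h c)
weight-cong {p} {p′} h (white ∷ c) =
  *-cong {1ℝ - p} {1ℝ - p′} {weight p c} {weight p′ c}
    (+-cong {1ℝ} {1ℝ} { - p} { - p′} (≃-refl {1ℝ}) (neg-cong {p} {p′} h)) (weight-cong {p} {p′} h c)

-- Probability as an expectation

filterᵇ-map : ∀ {A B : Set} (S : B → Bool) (f : A → B) xs →
              filterᵇ S (map f xs) ≡ map f (filterᵇ (λ x → S (f x)) xs)
filterᵇ-map S f []       = refl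
filterᵇ-map S f (x ∷ xs) with S (f x)
... | true  = cong (f x ∷_) (filterᵇ-map S f xs)
... | false = filterᵇ-map S f xs

filterᵇ-singleton : ∀ {A : Set} (S : A → Bool) x → filterᵇ S (x ∷ []) ≡ (if S x then x ∷ [] else [])
filterᵇ-singleton S x with S x
... | true  = refl
... | false = refl

totalWeight : ∀ {n} → ℝ → List (Coloring n) → ℝ
totalWeight p cs = foldr _+_ 0ℝ (map (weight p) cs)

totalWeight-cong : ∀ {p p′ n} → p ≃ p′ → (cs : List (Coloring n)) → totalWeight p cs ≃ totalWeight p′ cs
totalWeight-cong h [] = ≃-refl {0ℝ}
totalWeight-cong {p} {p′} h (c ∷ cs) =
  +-cong {weight p c} {weight p′ c} {totalWeight p cs} {totalWeight p′ cs}
    (weight-cong {p} {p′} h c) (totalWeight-cong {p} {p′} h cs)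

module _ (p : ℝ) (k : ℕ) where
  private
    a : ℚ
    a = seq p k

    total : ∀ {n} → List (Coloring n) → ℚ
    total cs = seq (totalWeight p cs) k

  total-++ : ∀ {n} (cs ds : List (Coloring n)) → total (cs ++ ds) ≡ total cs ℚ.+ total ds
  total-++ [] ds = sym (ℚ.+-identityˡ (total ds))
  total-++ (c ∷ cs) ds = trans (cong (seq (weight p c) k ℚ.+_) (total-++ cs ds))
    (sym (ℚ.+-assoc (seq (weight p c) k) (total cs) (total ds)))

  total-∷ : ∀ {n} x w (cs : List (Coloring n)) →
            (∀ {n} (c : Coloring n) → seq (weight p (x ∷ c)) k ≡ w ℚ.* seq (weight p c) k) →
            total (map (x ∷_) cs) ≡ w ℚ.* total cs
  total-∷ x w [] eq = sym (ℚ.*-zeroʳ w)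
  total-∷ x w (c ∷ cs) eq = trans (cong₂ ℚ._+_ (eq c) (total-∷ x w cs eq))
    (sym (ℚ.*-distribˡ-+ w (seq (weight p c) k) (total cs)))

  -- Real arithmetic acts termwise, so the identity is exact at each index and involves no limit.
  Pr≡E : ∀ {n} (S : Coloring n → Bool) → seq (Pr p S) k ≡ E a (λ c → 𝟙 (S c))
  Pr≡E {zero} S = trans (cong total (filterᵇ-singleton S [])) (singleton (S []))
    where
    singleton : ∀ b → total {0} (if b then [] ∷ [] else []) ≡ 𝟙 b
    singleton true  = refl
    singleton false = refl
  Pr≡E {suc n} S = begin
    total (filterᵇ S (bs ++ ws))
      ≡⟨ cong total (filter-++ (T? ∘ S) bs ws) ⟩
    total (filterᵇ S bs ++ filterᵇ S ws)
      ≡⟨ total-++ (filterᵇ S bs) (filterᵇ S ws) ⟩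
    total (filterᵇ S bs) ℚ.+ total (filterᵇ S ws)
      ≡⟨ cong₂ ℚ._+_ (cong total (filterᵇ-map S (blue ∷_) (colorings n)))
                     (cong total (filterᵇ-map S (white ∷_) (colorings n))) ⟩
    total (map (blue ∷_) (filterᵇ Sᵇ (colorings n))) ℚ.+ total (map (white ∷_) (filterᵇ Sʷ (colorings n)))
      ≡⟨ cong₂ ℚ._+_ (total-∷ blue a (filterᵇ Sᵇ (colorings n)) (λ _ → refl))
                     (total-∷ white (1ℚ ℚ.- a) (filterᵇ Sʷ (colorings n)) (λ _ → refl)) ⟩
    a ℚ.* seq (Pr p Sᵇ) k ℚ.+ (1ℚ ℚ.- a) ℚ.* seq (Pr p Sʷ) k
      ≡⟨ cong₂ (λ x y → a ℚ.* x ℚ.+ (1ℚ ℚ.- a) ℚ.* y) (Pr≡E Sᵇ) (Pr≡E Sʷ) ⟩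
    E a (λ c → 𝟙 (S c)) ∎
    where
    open ≡-Reasoning
    bs ws : List (Coloring (suc n))
    bs = map (blue ∷_) (colorings n)
    ws = map (white ∷_) (colorings n)
    Sᵇ Sʷ : Coloring n → Bool
    Sᵇ c = S (blue ∷ c)
    Sʷ c = S (white ∷ c)

-- From rational bounds to the real statement

clamp-≈ : ∀ p → ½ℝ ≤ p → p ≤ 1ℝ → seq p ≈ (λ k → clamp (seq p k))
clamp-≈ p ½≤p p≤1 .eventually ε 0<ε =
  let N , lower = ½≤p ε 0<ε
      M , upper = p≤1 ε 0<ε
  in N ℕ.⊔ M , λ k N≤k → clamp-close (seq p k) (ℚ.<⇒≤ 0<ε)
       (lower k (ℕ.m⊔n≤o⇒m≤o N M N≤k)) (upper k (ℕ.m⊔n≤o⇒n≤o N M N≤k))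

does-true : ∀ {A : Set} (a? : Dec A) → does a? ≡ true → A
does-true (yes a) _ = a

approximation : ∀ x {η} → 0ℚ ℚ.< η → ∃[ ρ ] ∃[ K ] (∀ k → K ℕ.≤ k →
                seq x k ℚ.≤ ρ ℚ.+ η × ρ ℚ.≤ seq x k ℚ.+ η)
approximation x {η} 0<η = let K , h = cauchy x η 0<η in seq x K , K , λ k K≤k →
  ∣x-y∣≤e⇒x≤y+e (seq x k) (seq x K) (h k K K≤k ℕ.≤-refl) ,
  ∣x-y∣≤e⇒x≤y+e (seq x K) (seq x k) (h K k ℕ.≤-refl K≤k)

module _ {p p′ : ℝ} (p≈p′ : p ≃ p′) (½≤p′ : ∀ k → ½ ℚ.≤ seq p′ k) (p′≤1 : ∀ k → seq p′ k ℚ.≤ 1ℚ)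
         {ε : ℝ} {η : ℚ} (0<η : 0ℚ ℚ.< η) {Nₑ : ℕ} (32η≤ε : ∀ k → Nₑ ℕ.≤ k → ι 32 ℚ.* η ℚ.≤ seq ε k)
         {ρ : ℚ} {K₀ : ℕ}
         (close : ∀ k → K₀ ℕ.≤ k → seq (density p′) k ℚ.≤ ρ ℚ.+ η × ρ ℚ.≤ seq (density p′) k ℚ.+ η) where
  private
    0≤η : 0ℚ ℚ.≤ η
    0≤η = ℚ.<⇒≤ 0<η

    D : ℕ → ℚ
    D = seq (density p′)

  ¼≤D : ∀ k → ¼ ℚ.≤ D k
  ¼≤D k = ¼≤density (½≤p′ k) (p′≤1 k) (density-equation p′ k)

  scale : ∀ n {x y} → x ℚ.≤ y → x ℚ.* ι n ℚ.≤ y ℚ.* ι n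
  scale n = ℚ.*-monoʳ-≤-nonNeg (ι n) {{ℚ.nonNegative (0≤ι n)}}

  weaken : ∀ {x y z} → 0ℚ ℚ.< z → x ℚ.≤ y → x ℚ.≤ y ℚ.+ z
  weaken {z = z} 0<z x≤y = ℚ.≤-trans x≤y (≤-by z (ℚ.<⇒≤ 0<z) refl)

  lower : ∀ n F → (ρ ℚ.- ι 3 ℚ.* η) ℚ.* ι n ℚ.≤ ι F → (1ℝ - ε) * density p * fromℕ n ≤ fromℕ F
  lower n F lo = ≤-respˡ {(1ℝ - ε) * density p′ * fromℕ n} {(1ℝ - ε) * density p * fromℕ n} {fromℕ F}
    (*-cong {(1ℝ - ε) * density p′} {(1ℝ - ε) * density p} {fromℕ n} {fromℕ n}
      (*-cong {1ℝ - ε} {1ℝ - ε} {density p′} {density p} (≃-refl {1ℝ - ε}) (density-cong {p′} {p} (≈-sym p≈p′)))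
      (≃-refl {fromℕ n}))
    λ z 0<z → K₀ ℕ.⊔ Nₑ , λ k N≤k → weaken 0<z (ℚ.≤-trans
      (scale n (relative-lower {D = D k} {ρ} 0≤η (32η≤ε k (ℕ.m⊔n≤o⇒n≤o K₀ Nₑ N≤k)) (¼≤D k)
        (proj₁ (close k (ℕ.m⊔n≤o⇒m≤o K₀ Nₑ N≤k))))) lo)

  upper : ∀ n F → ι F ℚ.≤ (ρ ℚ.+ ι 3 ℚ.* η) ℚ.* ι n → fromℕ F ≤ (1ℝ + ε) * density p * fromℕ n
  upper n F hi = ≤-respʳ {fromℕ F} {(1ℝ + ε) * density p′ * fromℕ n} {(1ℝ + ε) * density p * fromℕ n}
    (*-cong {(1ℝ + ε) * density p′} {(1ℝ + ε) * density p} {fromℕ n} {fromℕ n}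
      (*-cong {1ℝ + ε} {1ℝ + ε} {density p′} {density p} (≃-refl {1ℝ + ε}) (density-cong {p′} {p} (≈-sym p≈p′)))
      (≃-refl {fromℕ n}))
    λ z 0<z → K₀ ℕ.⊔ Nₑ , λ k N≤k → weaken 0<z (ℚ.≤-trans hi
      (scale n (relative-upper {D = D k} {ρ} 0≤η (32η≤ε k (ℕ.m⊔n≤o⇒n≤o K₀ Nₑ N≤k)) (¼≤D k)
        (proj₂ (close k (ℕ.m⊔n≤o⇒m≤o K₀ Nₑ N≤k))))))

  -- `S` does not depend on `k`, so the rational bounds at all late indices combine into one
  -- inequality between reals, first for `p′` and then for `p`.
  probable : ∀ {δ γ} ((d , _) : 0ℝ < δ) → γ ℚ.+ γ ℚ.≤ d → ∀ {n} (S : Coloring n → Bool) →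
    (∀ k → K₀ ℕ.≤ k → 1ℚ ℚ.≤ E (seq p′ k) (λ c → 𝟙 (S c)) ℚ.+ (γ ℚ.+ γ)) →
    1ℝ - δ ≤ Pr p S
  probable {δ} {γ} (d , 0<d , Nᵈ , 0+d≤δ) 2γ≤d {n} S likely =
    ≤-respʳ {1ℝ - δ} {Pr p′ S} {Pr p S} (totalWeight-cong {p′} {p} (≈-sym p≈p′) (filterᵇ S (colorings n)))
      λ z 0<z → K₀ ℕ.⊔ Nᵈ , λ k N≤k →
        let P = E (seq p′ k) (λ c → 𝟙 (S c))
            d≤δ : d ℚ.≤ seq δ k
            d≤δ = subst (ℚ._≤ seq δ k) (ℚ.+-identityˡ d) (0+d≤δ k (ℕ.m⊔n≤o⇒n≤o K₀ Nᵈ N≤k))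
            1≤P+δ : 1ℚ ℚ.≤ P ℚ.+ seq δ k
            1≤P+δ = ℚ.≤-trans (likely k (ℕ.m⊔n≤o⇒m≤o K₀ Nᵈ N≤k)) (ℚ.+-monoʳ-≤ P (ℚ.≤-trans 2γ≤d d≤δ))
        in weaken 0<z (ℚ.≤-trans
             (≤-by (P ℚ.+ seq δ k ℚ.- 1ℚ) (0≤y-x 1≤P+δ)
               (solve 2 (λ p d → (con 1ℚ :- d) :+ (p :+ d :- con 1ℚ) := p) refl P (seq δ k)))
             (ℚ.≤-reflexive (sym (Pr≡E p′ k S))))

  most-colorings-good : ∀ δ → 0ℝ < δ → ∃[ N ] ((n : ℕ) (3≤n : 3 ℕ.≤ n) → N ℕ.≤ n →
    let open MM (cycle n 3≤n) in
    ProbAtLeast p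
      (λ c → ∃[ t ] (t ℕ.≤ 1 ℕ.* ⌊log₂ n ⌋ × Stable (after t c)
        × (1ℝ - ε) * density p * fromℕ n ≤ fromℕ (blueCount (after t c))
        × fromℕ (blueCount (after t c)) ≤ (1ℝ + ε) * density p * fromℕ n))
      (1ℝ - δ))
  most-colorings-good δ 0<δ@(d , 0<d , _) =
    -- `2 γ ≤ d` keeps the probability of failure below `δ`, and `2 γ ≤ η` keeps the blue
    -- probability within `η` of its limit.
    let γ , 0<γ , 2γ≤η , 2γ≤d = half-min 0<η 0<d
        N , likely = good-likely-log 0<η 0<γ 2γ≤η
    in N , λ n 3≤n N≤n →
      let open MM (cycle n 3≤n)
          t = ⌊log₂ n ⌋
          S : Coloring n → Bool
          S c = does (good? 3≤n t ρ η c)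
      in S
       , (λ c good → let stable , lo , hi = does-true (good? 3≤n t ρ η c) good in
            t , ℕ.≤-reflexive (sym (ℕ.*-identityˡ t)) , stable
            , lower n (blueCount (after t c)) lo , upper n (blueCount (after t c)) hi)
       , probable {δ} {γ} 0<δ 2γ≤d S (λ k K₀≤k → likely n 3≤n N≤n {seq p′ k} {D k} {ρ}
            (½≤p′ k) (p′≤1 k) (density-equation p′ k) (proj₁ (close k K₀≤k)) (proj₂ (close k K₀≤k)))

theorem4p1 : (p : ℝ) → ½ℝ ≤ p → p ≤ 1ℝ → (ε : ℝ) → 0ℝ < ε →
    ∃[ C ] ((δ : ℝ) → 0ℝ < δ → ∃[ N ] ((n : ℕ) (3≤n : 3 ℕ.≤ n) → N ℕ.≤ n →
    let open MM (cycle n 3≤n) in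
    ProbAtLeast p
    (λ c → ∃[ t ] (t ℕ.≤ C ℕ.* ⌊log₂ n ⌋ × Stable (after t c)
    × (1ℝ - ε) * density p * fromℕ n ≤ fromℕ (blueCount (after t c))
    × fromℕ (blueCount (after t c)) ≤ (1ℝ + ε) * density p * fromℕ n))
    (1ℝ - δ)))
theorem4p1 p ½≤p p≤1 ε (e , 0<e , Nₑ , 0+e≤ε) =
  -- `e` is the rational lower bound on the late terms of `ε` contained in `0ℝ < ε`; the factor 32
  -- is the one that `relative-lower` and `relative-upper` ask for.
  let η , 0<η , 32η≡e = divide (ι 32) (ℚ.positive⁻¹ (ι 32)) 0<e
      p≈p′ = clamp-≈ p ½≤p p≤1
      p′ = mkℝ (λ k → clamp (seq p k)) (≈-cauchy p≈p′ (cauchy p))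
      ρ , K₀ , close = approximation (density p′) 0<η
  in 1 , most-colorings-good {p} {p′} p≈p′
           (λ k → ½≤clamp (seq p k)) (λ k → clamp≤1 (seq p k)) {ε} 0<η {Nₑ} (λ k Nₑ≤k → ℚ.≤-trans
             (ℚ.≤-reflexive (trans 32η≡e (sym (ℚ.+-identityˡ e)))) (0+e≤ε k Nₑ≤k)) {ρ} {K₀} close
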